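{- Let $G$ be a finite, simple, connected unicyclic graph. Then each of $\dim(G)$ and $\mathrm{edim}(G)$ equals either $L(G)+\max\{2-b(G),0\}$ or $L(G)+\max\{2-b(G),0\}+1$.
   Context: A unicyclic graph is a connected graph containing exactly one cycle $C$. For $v_i\in V(C)$, $T_{v_i}$ is the connected component of $G-E(C)$ containing $v_i$. $\dim(G)$ is the minimum size of a set $S\subseteq V(G)$ such that every two distinct vertices $u,v$ have some $s\in S$ with $d(u,s)\ne d(v,s)$; $\mathrm{edim}(G)$ is the minimum size of $S\subseteq V(G)$ such that every two distinct edges $e,f$ have some $s\in S$ with $d(e,s)\ne d(f,s)$, where $d(uv,s)=\min\{d(u,s),d(v,s)\}$. A thread is a path $u_1\cdots u_k$ in which all vertices have degree $2$ except $u_k$ which has degree $1$, and $u_1$ is adjacent to a vertex $v$ with $\deg(v)\ge3$ (the thread is attached to $v$). $\ell(v)$ is the number of threads attached to $v$, and $L(G)=\sum_{v\in V(G),\,\ell(v)>1}(\ell(v)-1)$. A vertex $v$ is branching if $v\notin V(C)$ and $\deg(v)\ge3$, or $v\in V(C)$ and $\deg(v)\ge 4$. A vertex $v_i\in V(C)$ is branch-active if $T_{v_i}$ contains a branching vertex, and $b(G)$ is the number of branch-active vertices on $C$. -}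

module Defs where

open import Data.Bool using (Bool; true; false; _∧_; _∨_; not; if_then_else_)
open import Data.Nat using (ℕ; zero; suc; _+_; _∸_; _≤_; _<_; _⊓_; _≤ᵇ_; _<ᵇ_; _≡ᵇ_)
open import Data.Nat.DivMod using (_mod_)
open import Data.Fin using (Fin; toℕ)
open import Data.Fin.Properties using (_≟_)
open import Data.Fin.Subset using (Subset; _∈_; ∣_∣)
open import Data.List using (List; []; _∷_; map; concatMap; allFin; upTo)
open import Data.Bool.ListAction using (any)
open import Data.Nat.ListAction using (sum)
open import Data.Product using (Σ; _×_; _,_; ∃; ∃-syntax)
open import Data.Sum using (_⊎_)
open import Data.Empty using (⊥)
open import Relation.Nullary using (¬_)
open import Relation.Nullary.Decidable using (⌊_⌋)
open import Relation.Binary.PropositionalEquality using (_≡_; _≢_)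
open import Function.Definitions using (Injective)

countB : {A : Set} → (A → Bool) → List A → ℕ
countB p []       = 0
countB p (x ∷ xs) = (if p x then 1 else 0) + countB p xs

record Graph (n : ℕ) : Set where
  field
    adj    : Fin n → Fin n → Bool
    sym    : ∀ u v → adj u v ≡ adj v u
    irrefl : ∀ u → adj u u ≡ false
open Graph public

module _ {n : ℕ} (G : Graph n) where

  deg : Fin n → ℕ
  deg v = countB (adj G v) (allFin n)

  data Walk : Fin n → Fin n → ℕ → Set where
    nil  : ∀ {u} → Walk u u 0
    cons : ∀ {u w v k} → adj G u w ≡ true → Walk w v k → Walk u v (suc k)

  Connected : Set
  Connected = ∀ u v → ∃[ k ] Walk u v k

  IsDist : Fin n → Fin n → ℕ → Set
  IsDist u v k = Walk u v k × (∀ j → j < k → ¬ Walk u v j)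

  IsEdgeDist : Fin n → Fin n → Fin n → ℕ → Set
  IsEdgeDist u v s k = ∃[ a ] ∃[ b ] (IsDist u s a × IsDist v s b × k ≡ a ⊓ b)

  Resolving : Subset n → Set
  Resolving S = ∀ u v → u ≢ v →
    ∃[ s ] (s ∈ S × ∃[ a ] ∃[ b ] (IsDist u s a × IsDist v s b × a ≢ b))

  IsDim : ℕ → Set
  IsDim k = (∃[ S ] (Resolving S × ∣ S ∣ ≡ k)) × (∀ S → Resolving S → k ≤ ∣ S ∣)

  SameEdge : Fin n → Fin n → Fin n → Fin n → Set
  SameEdge u v u' v' = (u ≡ u' × v ≡ v') ⊎ (u ≡ v' × v ≡ u')

  EdgeResolving : Subset n → Set
  EdgeResolving S = ∀ u v u' v' → adj G u v ≡ true → adj G u' v' ≡ true →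
    ¬ SameEdge u v u' v' →
    ∃[ s ] (s ∈ S × ∃[ a ] ∃[ b ] (IsEdgeDist u v s a × IsEdgeDist u' v' s b × a ≢ b))

  IsEdgeDim : ℕ → Set
  IsEdgeDim k = (∃[ S ] (EdgeResolving S × ∣ S ∣ ≡ k)) × (∀ S → EdgeResolving S → k ≤ ∣ S ∣)

  record Cycle : Set where
    field
      m     : ℕ
      vs    : Fin (3 + m) → Fin n
      inj   : Injective _≡_ _≡_ vs
      edges : ∀ i → adj G (vs i) (vs (suc (toℕ i) mod (3 + m))) ≡ true
  open Cycle public

  module _ (C : Cycle) where
    private
      k = 3 + m C
      nxt : Fin k → Fin k
      nxt i = suc (toℕ i) mod k
      _==_ : Fin n → Fin n → Bool
      x == y = ⌊ x ≟ y ⌋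

    isCEdge : Fin n → Fin n → Bool
    isCEdge u v = any (λ i → (vs C i == u ∧ vs C (nxt i) == v) ∨ (vs C i == v ∧ vs C (nxt i) == u))
                      (allFin k)

    onC : Fin n → Bool
    onC w = any (λ i → vs C i == w) (allFin k)

    adjT : Fin n → Fin n → Bool
    adjT u v = adj G u v ∧ not (isCEdge u v)

    reachT : ℕ → Fin n → Fin n → Bool
    reachT zero    u v = u == v
    reachT (suc j) u v = reachT j u v ∨ any (λ w → reachT j u w ∧ adjT w v) (allFin n)

    -- w ∈ T_u  (the component of G - E(C) containing u)
    inT : Fin n → Fin n → Bool
    inT u w = reachT n u w

    branching : Fin n → Bool
    branching w = (not (onC w) ∧ (3 ≤ᵇ deg w)) ∨ (onC w ∧ (4 ≤ᵇ deg w))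

    branchActive : Fin k → Bool
    branchActive i = any (λ w → inT (vs C i) w ∧ branching w) (allFin n)

    bG : ℕ
    bG = countB branchActive (allFin k)

  SameCycle : Cycle → Cycle → Set
  SameCycle C C' = ∀ u v → isCEdge C u v ≡ isCEdge C' u v

  Unicyclic : Set
  Unicyclic = Connected × Σ Cycle (λ C → ∀ C' → SameCycle C C')

  private
    _==_ : Fin n → Fin n → Bool
    x == y = ⌊ x ≟ y ⌋

    elem : Fin n → List (Fin n) → Bool
    elem x xs = any (x ==_) xs

    distinct : List (Fin n) → Bool
    distinct []       = true
    distinct (x ∷ xs) = not (elem x xs) ∧ distinct xs

    consecAdj : List (Fin n) → Bool
    consecAdj []           = true
    consecAdj (x ∷ [])     = true
    consecAdj (x ∷ y ∷ ys) = adj G x y ∧ consecAdj (y ∷ ys)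

    degOK : List (Fin n) → Bool
    degOK []           = false
    degOK (x ∷ [])     = deg x ≡ᵇ 1
    degOK (x ∷ y ∷ ys) = (deg x ≡ᵇ 2) ∧ degOK (y ∷ ys)

  isThread : Fin n → List (Fin n) → Bool
  isThread v []         = false
  isThread v (u₁ ∷ us)  =
    (3 ≤ᵇ deg v) ∧ adj G u₁ v ∧ distinct (u₁ ∷ us) ∧ consecAdj (u₁ ∷ us) ∧ degOK (u₁ ∷ us)

  -- all lists of vertices of length exactly j (each exactly once)
  listsOfLength : ℕ → List (List (Fin n))
  listsOfLength zero    = [] ∷ []
  listsOfLength (suc j) = concatMap (λ l → map (_∷ l) (allFin n)) (listsOfLength j)

  -- all lists of vertices of length 1 … n (a path has at most n vertices)
  candidatePaths : List (List (Fin n))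
  candidatePaths = concatMap (λ j → listsOfLength (suc j)) (upTo n)

  ℓ : Fin n → ℕ
  ℓ v = countB (isThread v) candidatePaths

  LG : ℕ
  LG = sum (map (λ v → if 1 <ᵇ ℓ v then ℓ v ∸ 1 else 0) (allFin n))

{-# OPTIONS --safe #-}

-- Every edge off the cycle C is a bridge, since a second route between its ends would close up
-- to another cycle.  So G is C with trees hanging off its vertices, and all distances split
-- through the cut vertices.
--
-- Lower bound: if two threads at v avoid S, their first vertices (and the edges joining them
-- to v) have the same distances to S; if S lies in a single tree, the two cycle neighbours (and
-- cycle edges) of its root are not distinguished.  Every vertex with two threads lies in a
-- branch-active tree, so for b(G) ≤ 1 the second requirement costs 2 - b(G) further vertices.
--
-- Upper bound: take all but one thread at each vertex, which already meets every branch-active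
-- tree, add 2 - b(G) vertices of C so that two trees are met, and one more so that three vertices
-- a, b, c of C with d(a,b) + d(b,c) + d(c,a) = |C| carry vertices of S.  Such a triple locates
-- the tree or cycle edge; inside a tree, one of any two subtrees below a common vertex meets S.
module Submission where

-- Two occupied trees may fail to resolve. If their roots are antipodal, the reflection of C in them
-- exchanges the neighbours of a root; if not, a vertex hanging over the shorter arc may have the
-- same distances as one on the longer arc. Three points spread around C cure both: no reflection
-- fixes all of them, and every cycle edge lies on a geodesic between two of them, so a detour
-- through another root cannot save length. This is the origin of the extra 1. The uniqueness of C
-- enters only through `no-bypass`; after that, all arguments compare distances. The hanging trees
-- are never built: `In x i` describes the tree at `c i` by equations between distances, and being a
-- descendant is being on the far side of a bridge. A vertex and a tree edge enter the final
-- comparison alike, as a distance function together with a height, so a single set serves both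
-- dimensions.

open import Defs hiding (sym; m; inj; edges)
open import Data.Bool as Bool using (Bool; true; false; T; _∧_; _∨_; not; if_then_else_)
open import Data.Bool.ListAction using (any)
open import Data.Bool.Properties using (T-≡; T-∧; T?; ∧-zeroʳ; ∨-zeroʳ; ∨-comm; ∨-identityʳ)
open import Data.Empty using (⊥; ⊥-elim)
open import Data.Fin using (Fin; zero; suc; toℕ; fromℕ; inject₁)
import Data.Fin.Properties as Fin
open import Data.Fin.Relation.Unary.Top using (view; ‵fromℕ; ‵inject₁)
open import Data.Fin.Subset as Subset using (Subset; inside; outside; ∣_∣; ⁅_⁆; _∪_)
open import Data.Fin.Subset.Properties using (anySubset?; x∈⁅x⁆; x∈p∪q⁺; x∈p∧x≢y⇒x∈p-y; x∈p⇒∣p-x∣<∣p∣; ∣⁅x⁆∣≡1; ∣⊥∣≡0) renaming (_∈?_ to _∈ˢ?_)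
open import Data.List as List using (List; []; _∷_; _++_; length; allFin; map; concatMap; upTo; take; drop; filter)
import Data.List.Membership.DecPropositional as DecMembership
open import Data.List.Membership.Propositional using (_∈_; _∉_; lose; find)
open import Data.List.Membership.Propositional.Properties using (∈-∃++; ∈-filter⁻; ∈-filter⁺; ∈-allFin; ∈-concatMap⁺; ∈-concatMap⁻; ∈-map⁺; ∈-map⁻; ∈-upTo⁺; ∈-++⁺ˡ; ∈-++⁺ʳ; ∈-++⁻)
open import Data.List.Properties using (length-tabulate; length-drop; length-++)
open import Data.List.Relation.Binary.Disjoint.Propositional using (Disjoint)
open import Data.List.Relation.Unary.All as All using (All; []; _∷_)
import Data.List.Relation.Unary.All.Properties as All
open import Data.List.Relation.Unary.AllPairs as AllPairs using (AllPairs; []; _∷_)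
import Data.List.Relation.Unary.AllPairs.Properties as AllPairs
open import Data.List.Relation.Unary.Any as Any using (Any; here; there)
open import Data.List.Relation.Unary.Any.Properties using (any⁺; any⁻)
open import Data.List.Relation.Unary.Unique.Propositional using (Unique)
open import Data.List.Relation.Unary.Unique.Propositional.Properties using (allFin⁺; upTo⁺; map⁺; concat⁺; filter⁺)
open import Data.Nat
open import Data.Nat.DivMod using (_%_; _mod_; m<n⇒m%n≡m; n%n≡0; %-distribˡ-+; m%n%n≡m%n; [m+n]%n≡m%n)
open import Data.Nat.ListAction using (sum)
open import Data.Nat.Properties
import Data.Nat.Solver
open import Data.Product using (_×_; _,_; proj₁; proj₂; ∃-syntax; Σ-syntax)
open import Data.Sum as Sum using (_⊎_; inj₁; inj₂; [_,_]′)
open import Data.Vec as Vec using (Vec; []; _∷_)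
open import Data.Vec.N-ary using (N-ary; ∀ⁿ; curryⁿ; _$ⁿ_)
open import Function using (_∘_; Equivalence)
open import Relation.Binary.PropositionalEquality using (_≡_; _≢_; refl; sym; trans; cong; cong₂; subst; subst₂; module ≡-Reasoning)
open import Relation.Nullary using (¬_; yes; no; Dec; does; contradiction)
open import Relation.Nullary.Decidable using (⌊_⌋; _×-dec_; _⊎-dec_; _→-dec_; ¬?; decidable-stable; map′; dec-true; dec-false)

-- Linear arithmetic over the natural numbers by reflection

module LinearArithmetic where

  open import Data.Integer as ℤ using (ℤ; +_; -[1+_]; +[1+_])

  infixl 6 _:+_
  infix  5 _:≤_ _:<_ _:=_
  infixr 3 _:⇒_
  infix  4 ⊢_

  data Expr (n : ℕ) : Set where
    var  : Fin n → Expr n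
    con  : ℕ → Expr n
    _:+_ : Expr n → Expr n → Expr n

  data Formula (n : ℕ) : Set where
    _:≤_ _:=_ : Expr n → Expr n → Formula n
    :⊥        : Formula n

  _:<_ : ∀ {n} → Expr n → Expr n → Formula n
  a :< b = con 1 :+ a :≤ b

  data Sequent (n : ℕ) : Set where
    ⊢_   : Formula n → Sequent n
    _:⇒_ : Formula n → Sequent n → Sequent n

  ⟦_⟧ᵉ : ∀ {n} → Expr n → Vec ℕ n → ℕ
  ⟦ var i ⟧ᵉ  ρ = Vec.lookup ρ i
  ⟦ con c ⟧ᵉ  ρ = c
  ⟦ a :+ b ⟧ᵉ ρ = ⟦ a ⟧ᵉ ρ + ⟦ b ⟧ᵉ ρ

  ⟦_⟧ᶠ : ∀ {n} → Formula n → Vec ℕ n → Set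
  ⟦ a :≤ b ⟧ᶠ ρ = ⟦ a ⟧ᵉ ρ ≤ ⟦ b ⟧ᵉ ρ
  ⟦ a := b ⟧ᶠ ρ = ⟦ a ⟧ᵉ ρ ≡ ⟦ b ⟧ᵉ ρ
  ⟦ :⊥ ⟧ᶠ     ρ = ⊥

  ⟦_⟧ˢ : ∀ {n} → Sequent n → Vec ℕ n → Set
  ⟦ ⊢ φ ⟧ˢ    ρ = ⟦ φ ⟧ᶠ ρ
  ⟦ φ :⇒ s ⟧ˢ ρ = ⟦ φ ⟧ᶠ ρ → ⟦ s ⟧ˢ ρ

  -- A linear form is stored with its constant coefficient last.
  Form : ℕ → Set
  Form n = Vec ℕ (suc n)

  value : ∀ {n} → Form n → Vec ℕ n → ℕ
  value (c ∷ _)  []      = c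
  value (a ∷ as) (x ∷ ρ) = a * x + value as ρ

  constant : ∀ n → ℕ → Form n
  constant zero    c = c ∷ []
  constant (suc n) c = 0 ∷ constant n c

  variable# : ∀ {n} → Fin n → Form n
  variable# {suc n} zero    = 1 ∷ constant n 0
  variable# {suc n} (suc i) = 0 ∷ variable# i

  _⊞_ : ∀ {n} → Vec ℕ n → Vec ℕ n → Vec ℕ n
  _⊞_ = Vec.zipWith _+_

  _⊡_ : ∀ {n} → ℕ → Vec ℕ n → Vec ℕ n
  c ⊡ as = Vec.map (c *_) as

  normalise : ∀ {n} → Expr n → Form n
  normalise (var i)  = variable# i
  normalise (con c)  = constant _ c
  normalise (a :+ b) = normalise a ⊞ normalise b

  value-constant : ∀ {n} c (ρ : Vec ℕ n) → value (constant n c) ρ ≡ c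
  value-constant c []      = refl
  value-constant c (x ∷ ρ) = value-constant c ρ

  value-variable : ∀ {n} (i : Fin n) (ρ : Vec ℕ n) → value (variable# i) ρ ≡ Vec.lookup ρ i
  value-variable zero    (x ∷ ρ) =
    trans (cong₂ _+_ (*-identityˡ x) (value-constant 0 ρ)) (+-identityʳ x)
  value-variable (suc i) (x ∷ ρ) = value-variable i ρ

  open Data.Nat.Solver.+-*-Solver using () renaming (solve to ring; _:+_ to _⊕_; _:*_ to _⊗_; _:=_ to _⊜_)

  value-⊞ : ∀ {n} (as bs : Form n) ρ → value (as ⊞ bs) ρ ≡ value as ρ + value bs ρ
  value-⊞ (a ∷ [])         (b ∷ [])         []      = refl
  value-⊞ (a ∷ as@(_ ∷ _)) (b ∷ bs@(_ ∷ _)) (x ∷ ρ) = trans (cong (_+_ ((a + b) * x)) (value-⊞ as bs ρ))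
    (ring 5 (λ a b x u v → (a ⊕ b) ⊗ x ⊕ (u ⊕ v) ⊜ (a ⊗ x ⊕ u) ⊕ (b ⊗ x ⊕ v)) refl a b x (value as ρ) (value bs ρ))

  value-⊡ : ∀ {n} c (as : Form n) ρ → value (c ⊡ as) ρ ≡ c * value as ρ
  value-⊡ c (a ∷ [])         []      = refl
  value-⊡ c (a ∷ as@(_ ∷ _)) (x ∷ ρ) = trans (cong (_+_ (c * a * x)) (value-⊡ c as ρ))
    (ring 4 (λ c a x u → c ⊗ a ⊗ x ⊕ c ⊗ u ⊜ c ⊗ (a ⊗ x ⊕ u)) refl c a x (value as ρ))

  normalise-correct : ∀ {n} (e : Expr n) ρ → value (normalise e) ρ ≡ ⟦ e ⟧ᵉ ρ
  normalise-correct (var i)  ρ = value-variable i ρ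
  normalise-correct (con c)  ρ = value-constant c ρ
  normalise-correct (a :+ b) ρ = trans (value-⊞ (normalise a) (normalise b) ρ)
    (cong₂ _+_ (normalise-correct a ρ) (normalise-correct b ρ))

  Inequality : ℕ → Set
  Inequality n = Form n × Form n

  Holds : ∀ {n} → Vec ℕ n → Inequality n → Set
  Holds ρ (l , r) = value l ρ ≤ value r ρ

  combination : ∀ {n} → List ℕ → List (Inequality n) → Inequality n
  combination (c ∷ cs) ((l , r) ∷ hs) = let L , R = combination cs hs in (c ⊡ l) ⊞ L , (c ⊡ r) ⊞ R
  -- A multiplier list of the wrong length is simply cut off, so the search that supplies it needs
  -- no correctness proof.
  combination _        _              = constant _ 0 , constant _ 0

  combination-holds : ∀ {n} cs (hs : List (Inequality n)) ρ → All (Holds ρ) hs → Holds ρ (combination cs hs)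
  combination-holds []       []             ρ []       = ≤-refl
  combination-holds []       (_ ∷ _)        ρ (_ ∷ _)  = ≤-refl
  combination-holds (_ ∷ _)  []             ρ []       = ≤-refl
  combination-holds (c ∷ cs) ((l , r) ∷ hs) ρ (p ∷ ps) = begin
    value ((c ⊡ l) ⊞ L) ρ         ≡⟨ expand l L ⟩
    c * value l ρ + value L ρ     ≤⟨ +-mono-≤ (*-monoʳ-≤ c p) (combination-holds cs hs ρ ps) ⟩
    c * value r ρ + value R ρ     ≡⟨ expand r R ⟨
    value ((c ⊡ r) ⊞ R) ρ         ∎
    where
      open ≤-Reasoning
      L = proj₁ (combination cs hs)
      R = proj₂ (combination cs hs)
      expand : ∀ as bs → value ((c ⊡ as) ⊞ bs) ρ ≡ c * value as ρ + value bs ρ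
      expand as bs = trans (value-⊞ (c ⊡ as) bs ρ) (cong (_+ value bs ρ) (value-⊡ c as ρ))

  -- Comparing coefficient by coefficient suffices because the variables are nonnegative; strictness
  -- is asked of the constants alone.
  exceeds : ∀ {n} → Form n → Form n → Bool
  exceeds (a ∷ [])         (b ∷ [])         = b <ᵇ a
  exceeds (a ∷ as@(_ ∷ _)) (b ∷ bs@(_ ∷ _)) = (b ≤ᵇ a) ∧ exceeds as bs

  exceeds-sound : ∀ {n} (as bs : Form n) ρ → T (exceeds as bs) → value bs ρ < value as ρ
  exceeds-sound (a ∷ [])         (b ∷ [])         []      t = <ᵇ⇒< b a t
  exceeds-sound (a ∷ as@(_ ∷ _)) (b ∷ bs@(_ ∷ _)) (x ∷ ρ) t with Equivalence.to T-∧ t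
  ... | b≤a , t′ = +-mono-≤-< (*-monoˡ-≤ x (≤ᵇ⇒≤ b a b≤a)) (exceeds-sound as bs ρ t′)

  -- Fourier–Motzkin elimination on rows (l - r, multipliers) meaning l - r ≤ 0.  As all variables
  -- are natural numbers, a row with a nonnegative leading coefficient may simply drop it.
  Row : Set
  Row = List ℤ × List ℕ

  scaleRow : ℕ → Row → Row
  scaleRow c (as , cs) = List.map (+ c ℤ.*_) as , List.map (c *_) cs

  addRow : Row → Row → Row
  addRow (as , cs) (bs , ds) = List.zipWith ℤ._+_ as bs , List.zipWith _+_ cs ds

  eliminate : List Row → List Row × List (ℕ × Row) × List (ℕ × Row)
  eliminate []                         = [] , [] , []
  eliminate (([] , _) ∷ rows)          = eliminate rows
  eliminate ((a ∷ as , cs) ∷ rows) with eliminate rows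
  ... | keep , pos , neg with a
  ...   | + zero     = (as , cs) ∷ keep , pos , neg
  ...   | +[1+ k ]   = (as , cs) ∷ keep , (suc k , as , cs) ∷ pos , neg
  ...   | -[1+ k ]   = keep , pos , (suc k , as , cs) ∷ neg

  -- Untrusted search: only the combination built from its multipliers is checked, by `exceeds`. A
  -- surviving row with positive constant reads "positive ≤ 0" and is the certificate sought; if
  -- there is none, the empty list fails the check.
  refutation : ℕ → List Row → List ℕ
  refutation zero    rows = List.foldr pick [] rows
    where
      pick : Row → List ℕ → List ℕ
      pick (+[1+ _ ] ∷ _ , cs) _    = cs
      pick _                   rest = rest
  refutation (suc n) rows = let keep , pos , neg = eliminate rows in
    refutation n (keep ++ List.concatMap (λ (a , p) → List.map (λ (b , q) → addRow (scaleRow b p) (scaleRow a q)) neg) pos)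

  rows : ∀ {n} → List (Inequality n) → List Row
  rows {n} hs = go 0 hs
    where
      unit : ℕ → List ℕ
      unit i = List.map (λ j → if i ≡ᵇ j then 1 else 0) (List.upTo (List.length hs))
      go : ℕ → List (Inequality n) → List Row
      go i []             = []
      go i ((l , r) ∷ hs) = (Vec.toList (Vec.zipWith ℤ._⊖_ l r) , unit i) ∷ go (suc i) hs

  inconsistent : ∀ {n} → List (Inequality n) → Bool
  inconsistent {n} hs = let L , R = combination (refutation n (rows hs)) hs in exceeds L R

  inconsistent-sound : ∀ {n} (hs : List (Inequality n)) ρ → T (inconsistent hs) → All (Holds ρ) hs → ⊥
  inconsistent-sound {n} hs ρ t ps = let c = refutation n (rows hs) ; L , R = combination c hs in
    <⇒≱ (exceeds-sound L R ρ t) (combination-holds c hs ρ ps)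

  inequality : ∀ {n} → Expr n → Expr n → Inequality n
  inequality a b = normalise a , normalise b

  holds : ∀ {n} (a b : Expr n) ρ → ⟦ a ⟧ᵉ ρ ≤ ⟦ b ⟧ᵉ ρ → Holds ρ (inequality a b)
  holds a b ρ a≤b rewrite normalise-correct a ρ | normalise-correct b ρ = a≤b

  assume : ∀ {n} → Formula n → List (Inequality n) → List (Inequality n)
  assume (a :≤ b) hs = inequality a b ∷ hs
  assume (a := b) hs = inequality a b ∷ inequality b a ∷ hs
  assume :⊥       hs = hs

  valid : ∀ {n} → List (Inequality n) → Sequent n → Bool
  valid hs (⊢ (a :≤ b)) = inconsistent (inequality (con 1 :+ b) a ∷ hs)
  valid hs (⊢ (a := b)) = valid hs (⊢ (a :≤ b)) ∧ valid hs (⊢ (b :≤ a))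
  valid hs (⊢ :⊥)       = inconsistent hs
  valid hs (φ :⇒ s)     = valid (assume φ hs) s

  valid-≤ : ∀ {n} (hs : List (Inequality n)) a b → T (valid hs (⊢ (a :≤ b))) → ∀ ρ → All (Holds ρ) hs → ⟦ a ⟧ᵉ ρ ≤ ⟦ b ⟧ᵉ ρ
  valid-≤ hs a b t ρ ps = ≮⇒≥ λ b<a → inconsistent-sound (inequality (con 1 :+ b) a ∷ hs) ρ t (holds (con 1 :+ b) a ρ b<a ∷ ps)

  valid-sound : ∀ {n} (hs : List (Inequality n)) s → T (valid hs s) → ∀ ρ → All (Holds ρ) hs → ⟦ s ⟧ˢ ρ
  valid-sound hs (⊢ (a :≤ b))     t ρ ps   = valid-≤ hs a b t ρ ps
  valid-sound hs (⊢ (a := b))     t ρ ps   =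
    let t₁ , t₂ = Equivalence.to T-∧ t in ≤-antisym (valid-≤ hs a b t₁ ρ ps) (valid-≤ hs b a t₂ ρ ps)
  valid-sound hs (⊢ :⊥)           t ρ ps   = inconsistent-sound hs ρ t ps
  valid-sound hs ((a :≤ b) :⇒ s)  t ρ ps p = valid-sound _ s t ρ (holds a b ρ p ∷ ps)
  valid-sound hs ((a := b) :⇒ s)  t ρ ps p =
    valid-sound _ s t ρ (holds a b ρ (≤-reflexive p) ∷ holds b a ρ (≤-reflexive (sym p)) ∷ ps)
  valid-sound hs (:⊥ :⇒ s)        t ρ ps p = ⊥-elim p

  curry-∀ⁿ : ∀ n {P : Vec ℕ n → Set} → (∀ ρ → P ρ) → ∀ⁿ n (curryⁿ P)
  curry-∀ⁿ zero    p = p []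
  curry-∀ⁿ (suc n) p = λ x → curry-∀ⁿ n (λ ρ → p (x ∷ ρ))

  variables : ∀ n → Vec (Expr n) n
  variables n = Vec.map var (Vec.allFin n)

  -- The hidden argument is a closed Boolean test that evaluates to the unit type, so a call
  -- consists of the number of variables, the sequent, the values and the hypotheses.
  lin : ∀ n (s : N-ary n (Expr n) (Sequent n)) {_ : T (valid [] (s $ⁿ variables n))} →
        ∀ⁿ n (curryⁿ ⟦ s $ⁿ variables n ⟧ˢ)
  lin n s {t} = curry-∀ⁿ n (λ ρ → valid-sound [] (s $ⁿ variables n) t ρ [])

open LinearArithmetic using (lin; con; _:+_; _:≤_; _:<_; _:=_; :⊥; _:⇒_; ⊢_)

-- Counting in lists and finite subsets

module Counting where

  ∧-true : ∀ {x y} → x ∧ y ≡ true → x ≡ true × y ≡ true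
  ∧-true {true} {true} _ = refl , refl

  not-true : ∀ {x} → not x ≡ true → x ≡ false
  not-true {false} _ = refl

  ≟-true : ∀ {n} {x y : Fin n} → ⌊ x Fin.≟ y ⌋ ≡ true → x ≡ y
  ≟-true {x = x} {y} eq with x Fin.≟ y
  ... | yes x≡y = x≡y

  ≟-refl : ∀ {n} (x : Fin n) → ⌊ x Fin.≟ x ⌋ ≡ true
  ≟-refl x with x Fin.≟ x
  ... | yes _  = refl
  ... | no x≢x = contradiction refl x≢x

  any-true : ∀ {A : Set} (p : A → Bool) xs → any p xs ≡ true → ∃[ x ] (x ∈ xs × p x ≡ true)
  any-true p xs eq = go (any⁻ p xs (Equivalence.from T-≡ eq))
    where
    go : ∀ {xs} → Any (T ∘ p) xs → ∃[ x ] (x ∈ xs × p x ≡ true)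
    go (here px)   = _ , here refl , Equivalence.to T-≡ px
    go (there pxs) = let x , x∈xs , px = go pxs in x , there x∈xs , px

  true-any : ∀ {A : Set} (p : A → Bool) {x xs} → x ∈ xs → p x ≡ true → any p xs ≡ true
  true-any p x∈xs px = Equivalence.to T-≡ (any⁺ p (Any.map (λ { refl → Equivalence.from T-≡ px }) x∈xs))

  module _ {A : Set} where

    Unique-⊆-length : {xs ys : List A} → Unique xs → (∀ {x} → x ∈ xs → x ∈ ys) → length xs ≤ length ys
    Unique-⊆-length {[]}     _         _  = z≤n
    Unique-⊆-length {x ∷ xs} (x∉ ∷ u) sub with ∈-∃++ (sub (here refl))
    ... | as , bs , refl = begin
      suc (length xs)              ≤⟨ s≤s (Unique-⊆-length u sub′) ⟩
      suc (length (as ++ bs))      ≡⟨ cong suc (length-++ as) ⟩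
      suc (length as + length bs)  ≡⟨ +-suc (length as) (length bs) ⟨
      length as + suc (length bs)  ≡⟨ length-++ as ⟨
      length (as ++ x ∷ bs)        ∎
      where
      open ≤-Reasoning
      sub′ : ∀ {y} → y ∈ xs → y ∈ as ++ bs
      sub′ y∈xs with ∈-++⁻ as (sub (there y∈xs))
      ... | inj₁ y∈as         = ∈-++⁺ˡ y∈as
      ... | inj₂ (here refl)  = ⊥-elim (All.lookup x∉ y∈xs refl)
      ... | inj₂ (there y∈bs) = ∈-++⁺ʳ as y∈bs

    select : (A → Bool) → List A → List A
    select p = filter (λ x → T? (p x))

    length-select : ∀ p xs → length (select p xs) ≡ countB p xs
    length-select p []       = refl
    length-select p (x ∷ xs) with p x
    ... | true  = cong suc (length-select p xs)
    ... | false = length-select p xs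

    ∈-select⁻ : ∀ p {x} xs → x ∈ select p xs → x ∈ xs × p x ≡ true
    ∈-select⁻ p xs x∈ = let x∈xs , t = ∈-filter⁻ (λ x → T? (p x)) x∈ in x∈xs , Equivalence.to T-≡ t

    ∈-select⁺ : ∀ p {x} {xs} → x ∈ xs → p x ≡ true → x ∈ select p xs
    ∈-select⁺ p x∈xs px = ∈-filter⁺ (λ x → T? (p x)) x∈xs (Equivalence.from T-≡ px)

    Unique-select : ∀ p {xs} → Unique xs → Unique (select p xs)
    Unique-select p = filter⁺ (λ x → T? (p x))

  module _ {n} (p : Fin n → Bool) where

    countB-≤ : ∀ ys → (∀ x → p x ≡ true → x ∈ ys) → countB p (allFin n) ≤ length ys
    countB-≤ ys sub = subst (_≤ length ys) (length-select p (allFin n))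
      (Unique-⊆-length (Unique-select p (allFin⁺ n)) (λ x∈ → sub _ (proj₂ (∈-select⁻ p (allFin n) x∈))))

    countB-≥ : ∀ {xs} → Unique xs → (∀ {x} → x ∈ xs → p x ≡ true) → length xs ≤ countB p (allFin n)
    countB-≥ {xs} u ok = subst (length xs ≤_) (length-select p (allFin n))
      (Unique-⊆-length u (λ x∈ → ∈-select⁺ p (∈-allFin _) (ok x∈)))

    -- The form in which degrees and `bG` are exploited: a count above the number of known examples
    -- yields a new one.
    countB-fresh : ∀ ys → length ys < countB p (allFin n) → ∃[ x ] (p x ≡ true × x ∉ ys)
    countB-fresh ys lt with Fin.any? (λ x → (p x Bool.≟ true) ×-dec ¬? (DecMembership._∈?_ Fin._≟_ x ys))
    ... | yes found = found
    ... | no none   = contradiction (countB-≤ ys covered) (<⇒≱ lt)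
      where
      covered : ∀ x → p x ≡ true → x ∈ ys
      covered x px = decidable-stable (DecMembership._∈?_ Fin._≟_ x ys) (λ x∉ys → none (x , px , x∉ys))

  Unique-∣∣ : ∀ {n} {xs : List (Fin n)} (S : Subset n) → Unique xs → (∀ {x} → x ∈ xs → x Subset.∈ S) → length xs ≤ ∣ S ∣
  Unique-∣∣ {xs = []}     S _        _   = z≤n
  Unique-∣∣ {xs = x ∷ xs} S (x∉ ∷ u) sub = ≤-trans
    (s≤s (Unique-∣∣ (S Subset.- x) u (λ y∈ → x∈p∧x≢y⇒x∈p-y (sub (there y∈)) (λ y≡x → All.lookup x∉ y∈ (sym y≡x)))))
    (x∈p⇒∣p-x∣<∣p∣ (sub (here refl)))

  fromList : ∀ {n} → List (Fin n) → Subset n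
  fromList = List.foldr (λ x S → ⁅ x ⁆ ∪ S) Subset.⊥

  ∈-fromList : ∀ {n} {x : Fin n} {xs} → x ∈ xs → x Subset.∈ fromList xs
  ∈-fromList (here refl) = x∈p∪q⁺ (inj₁ (x∈⁅x⁆ _))
  ∈-fromList (there x∈)  = x∈p∪q⁺ (inj₂ (∈-fromList x∈))

  ∣∪∣-≤ : ∀ {n} (p q : Subset n) → ∣ p ∪ q ∣ ≤ ∣ p ∣ + ∣ q ∣
  ∣∪∣-≤ []            []            = z≤n
  ∣∪∣-≤ (inside ∷ p)  (inside ∷ q)  = s≤s (≤-trans (∣∪∣-≤ p q) (+-monoʳ-≤ ∣ p ∣ (n≤1+n ∣ q ∣)))
  ∣∪∣-≤ (inside ∷ p)  (outside ∷ q) = s≤s (∣∪∣-≤ p q)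
  ∣∪∣-≤ (outside ∷ p) (inside ∷ q)  = ≤-trans (s≤s (∣∪∣-≤ p q)) (≤-reflexive (sym (+-suc ∣ p ∣ ∣ q ∣)))
  ∣∪∣-≤ (outside ∷ p) (outside ∷ q) = ∣∪∣-≤ p q

  ∣fromList∣-≤ : ∀ {n} (xs : List (Fin n)) → ∣ fromList xs ∣ ≤ length xs
  ∣fromList∣-≤ {n} []   = ≤-reflexive (∣⊥∣≡0 n)
  ∣fromList∣-≤ (x ∷ xs) = ≤-trans (∣∪∣-≤ ⁅ x ⁆ (fromList xs)) (+-mono-≤ (≤-reflexive (∣⁅x⁆∣≡1 x)) (∣fromList∣-≤ xs))

open Counting

-- Walks and shortest walks

module Walks {n : ℕ} (G : Graph n) where

  adj-sym : ∀ {u v} → adj G u v ≡ true → adj G v u ≡ true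
  adj-sym {u} {v} = trans (Graph.sym G v u)

  adj-≢ : ∀ {u v} → adj G u v ≡ true → u ≢ v
  adj-≢ {u} e refl with trans (sym e) (Graph.irrefl G u)
  ... | ()

  infixr 5 _∙_

  _∙_ : ∀ {u v w k l} → Walk G u v k → Walk G v w l → Walk G u w (k + l)
  nil      ∙ q = q
  cons e p ∙ q = cons e (p ∙ q)

  reverse : ∀ {u v k} → Walk G u v k → Walk G v u k
  reverse nil                  = nil
  reverse {k = suc k} (cons e p) = subst (Walk G _ _) (+-comm k 1) (reverse p ∙ cons (adj-sym e) nil)

  walk? : ∀ k u v → Dec (Walk G u v k)
  walk? zero    u v = map′ (λ { refl → nil }) (λ { nil → refl }) (u Fin.≟ v)
  walk? (suc k) u v = map′ (λ (w , e , p) → cons e p) (λ { (cons e p) → _ , e , p })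
    (Fin.any? (λ w → (adj G u w Bool.≟ true) ×-dec walk? k w v))

  shortest : ∀ {u v k} → Walk G u v k → ∃[ d ] IsDist G u v d
  shortest {u} {v} {k} p = search 0 k (+-identityʳ k) (λ _ ())
    where
    search : ∀ d fuel → fuel + d ≡ k → (∀ j → j < d → ¬ Walk G u v j) → ∃[ d ] IsDist G u v d
    search d fuel eq none with walk? d u v
    ... | yes q = d , q , none
    search d zero       refl none | no ¬q = contradiction p ¬q
    search d (suc fuel) eq   none | no ¬q = search (suc d) fuel (trans (+-suc fuel d) eq) none′
      where
      none′ : ∀ j → j < suc d → ¬ Walk G u v j
      none′ j j<1+d q with m≤n⇒m<n∨m≡n (s≤s⁻¹ j<1+d)
      ... | inj₁ j<d  = none j j<d q
      ... | inj₂ refl = ¬q q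

  IsDist-unique : ∀ {u v a b} → IsDist G u v a → IsDist G u v b → a ≡ b
  IsDist-unique (p , p-min) (q , q-min) = ≤-antisym (≮⇒≥ (λ b<a → p-min _ b<a q)) (≮⇒≥ (λ a<b → q-min _ a<b p))

  at : ∀ {u v k} → Walk G u v k → Fin (suc k) → Fin n
  at {u} nil     zero    = u
  at {u} (cons e p) zero    = u
  at (cons e p) (suc i) = at p i

  at-zero : ∀ {u v k} (p : Walk G u v k) → at p zero ≡ u
  at-zero nil        = refl
  at-zero (cons e p) = refl

  at-last : ∀ {u v k} (p : Walk G u v k) → at p (fromℕ k) ≡ v
  at-last nil        = refl
  at-last (cons e p) = at-last p

  at-adj : ∀ {u v k} (p : Walk G u v k) (i : Fin k) → adj G (at p (inject₁ i)) (at p (suc i)) ≡ true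
  at-adj (cons {u} e p) zero    = subst (λ w → adj G u w ≡ true) (sym (at-zero p)) e
  at-adj (cons e p) (suc i) = at-adj p i

  suffix : ∀ {u v k} (p : Walk G u v k) (i : Fin (suc k)) → ∃[ j ] (j ≤ k × Walk G (at p i) v j)
  suffix p@nil        zero    = _ , ≤-refl , p
  suffix p@(cons _ _) zero    = _ , ≤-refl , p
  suffix (cons e p)   (suc i) = let j , j≤ , q = suffix p i in j , m≤n⇒m≤1+n j≤ , q

  -- A repetition would allow a loop to be cut out, giving a shorter walk. Minimality passes to the
  -- tail, since a shorter tail would shorten the whole walk.
  at-injective : ∀ {u v k} (p : Walk G u v k) → (∀ j → j < k → ¬ Walk G u v j) → ∀ {i j} → at p i ≡ at p j → i ≡ j
  at-injective p          mini {zero}  {zero}  eq = refl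
  at-injective (cons e p) mini {suc i} {suc j} eq =
    cong suc (at-injective p (λ l l<k q → mini (suc l) (s≤s l<k) (cons e q)) eq)
  at-injective (cons e p) mini {zero}  {suc j} eq = let l , l≤ , q = suffix p j in
    ⊥-elim (mini l (s≤s l≤) (subst (λ x → Walk G x _ l) (sym eq) q))
  at-injective (cons e p) mini {suc i} {zero}  eq = let l , l≤ , q = suffix p i in
    ⊥-elim (mini l (s≤s l≤) (subst (λ x → Walk G x _ l) eq q))

-- The cyclic successor, and closing a walk to a cycle

abstract
  -- Sealed so that modular arithmetic does not unfold in later goals; only `next-mod` and
  -- `toℕ-next` see through it.
  next : ∀ {k} → Fin (suc k) → Fin (suc k)
  next {k} i = suc (toℕ i) mod suc k

  next-mod : ∀ {k} (i : Fin (suc k)) → next i ≡ suc (toℕ i) mod suc k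
  next-mod i = refl

  toℕ-next : ∀ {k} (i : Fin (suc k)) → toℕ (next i) ≡ suc (toℕ i) % suc k
  toℕ-next i = Fin.toℕ-fromℕ< _

next-inject₁ : ∀ {k} (i : Fin k) → next (inject₁ i) ≡ suc i
next-inject₁ {k} i = Fin.toℕ-injective (begin
  toℕ (next (inject₁ i))          ≡⟨ toℕ-next (inject₁ i) ⟩
  suc (toℕ (inject₁ i)) % suc k   ≡⟨ cong (λ t → suc t % suc k) (Fin.toℕ-inject₁ i) ⟩
  suc (toℕ i) % suc k             ≡⟨ m<n⇒m%n≡m (s≤s (Fin.toℕ<n i)) ⟩
  suc (toℕ i)                     ∎)
  where open ≡-Reasoning

next-fromℕ : ∀ k → next (fromℕ k) ≡ zero
next-fromℕ k = Fin.toℕ-injective (trans (toℕ-next (fromℕ k))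
  (trans (cong (λ t → suc t % suc k) (Fin.toℕ-fromℕ k)) (n%n≡0 (suc k))))

module _ {n : ℕ} (G : Graph n) (C : Cycle G) where

  private
    edgeTest : Fin n → Fin n → Fin (3 + Cycle.m C) → Bool
    edgeTest u v i = let j = suc (toℕ i) mod (3 + Cycle.m C) in
      (⌊ vs C i Fin.≟ u ⌋ ∧ ⌊ vs C j Fin.≟ v ⌋) ∨ (⌊ vs C i Fin.≟ v ⌋ ∧ ⌊ vs C j Fin.≟ u ⌋)

  isCEdge-intro : ∀ i {u v} → vs C i ≡ u → vs C (next i) ≡ v → isCEdge G C u v ≡ true
  isCEdge-intro i {u} {v} refl refl = true-any (edgeTest u v) (∈-allFin i) eq
    where
    eq : edgeTest u v i ≡ true
    eq rewrite next-mod i | ≟-refl (vs C i) | ≟-refl (vs C (suc (toℕ i) mod (3 + Cycle.m C))) = refl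

  isCEdge-introʳ : ∀ i {u v} → vs C i ≡ v → vs C (next i) ≡ u → isCEdge G C u v ≡ true
  isCEdge-introʳ i {u} {v} refl refl = true-any (edgeTest u v) (∈-allFin i) eq
    where
    eq : edgeTest u v i ≡ true
    eq rewrite next-mod i | ≟-refl (vs C i) | ≟-refl (vs C (suc (toℕ i) mod (3 + Cycle.m C))) = ∨-zeroʳ _

  isCEdge-elim : ∀ {u v} → isCEdge G C u v ≡ true → ∃[ i ] ((vs C i ≡ u × vs C (next i) ≡ v) ⊎ (vs C i ≡ v × vs C (next i) ≡ u))
  isCEdge-elim {u} {v} eq with any-true (edgeTest u v) (allFin _) eq
  ... | i , _ , eq′ = i , subst (λ j → (vs C i ≡ u × vs C j ≡ v) ⊎ (vs C i ≡ v × vs C j ≡ u)) (sym (next-mod i)) (∨-cases eq′)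
    where
    ∨-cases : ∀ {a b c d : Fin n} → (⌊ a Fin.≟ b ⌋ ∧ ⌊ c Fin.≟ d ⌋) ∨ (⌊ a Fin.≟ d ⌋ ∧ ⌊ c Fin.≟ b ⌋) ≡ true →
              (a ≡ b × c ≡ d) ⊎ (a ≡ d × c ≡ b)
    ∨-cases {a} {b} {c} {d} eq with a Fin.≟ b | c Fin.≟ d | a Fin.≟ d | c Fin.≟ b
    ... | yes p | yes q | _     | _     = inj₁ (p , q)
    ... | _     | _     | yes p | yes q = inj₂ (p , q)
    ∨-cases () | yes p | no _  | yes _ | no _
    ∨-cases () | yes p | no _  | no _  | _
    ∨-cases () | no _  | _     | yes _ | no _
    ∨-cases () | no _  | _     | no _  | _

-- A shortest walk of length 2 + d visits 3 + d distinct vertices, so an edge of `G` between its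
-- ends closes it to a cycle with `m = d`. Length at least two excludes running along one edge and
-- back.
closeWalk : ∀ {n} (G H : Graph n) → (∀ {x y} → adj H x y ≡ true → adj G x y ≡ true) →
  ∀ {u v d} → IsDist H u v (2 + d) → adj G v u ≡ true → ∃[ C ] isCEdge G C u v ≡ true
closeWalk {n} G H sub {u} {v} {d} (p , mini) e = C , isCEdge-introʳ G C (fromℕ (2 + d)) (at-last p)
    (trans (cong (at p) (next-fromℕ (2 + d))) (at-zero p))
  where
  open Walks H
  edges : ∀ i → adj G (at p i) (at p (next i)) ≡ true
  edges i with view i
  ... | ‵fromℕ      rewrite next-fromℕ (2 + d) | at-last p | at-zero p = e
  ... | ‵inject₁ j  rewrite next-inject₁ j = sub (at-adj p j)
  C : Cycle G
  C = record { m = d ; vs = at p ; inj = at-injective p mini ; edges = λ i → subst (λ j → adj G (at p i) (at p j) ≡ true) (next-mod i) (edges i) }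

-- Distances in a connected graph

module Metric {n : ℕ} (G : Graph n) (conn : Connected G) where

  open Walks G

  abstract
    dist : Fin n → Fin n → ℕ
    dist u v = proj₁ (shortest (proj₂ (conn u v)))

    dist-isDist : ∀ u v → IsDist G u v (dist u v)
    dist-isDist u v = proj₂ (shortest (proj₂ (conn u v)))

  IsDist⇒≡ : ∀ {u v a} → IsDist G u v a → a ≡ dist u v
  IsDist⇒≡ p = IsDist-unique p (dist-isDist _ _)

  geodesic : ∀ u v → Walk G u v (dist u v)
  geodesic u v = proj₁ (dist-isDist u v)

  dist-≤ : ∀ {u v k} → Walk G u v k → dist u v ≤ k
  dist-≤ {u} {v} p = ≮⇒≥ (λ k<d → proj₂ (dist-isDist u v) _ k<d p)

  dist-refl : ∀ u → dist u u ≡ 0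
  dist-refl u = n≤0⇒n≡0 (dist-≤ nil)

  dist-sym : ∀ u v → dist u v ≡ dist v u
  dist-sym u v = ≤-antisym (dist-≤ (reverse (geodesic v u))) (dist-≤ (reverse (geodesic u v)))

  dist-triangle : ∀ u v w → dist u w ≤ dist u v + dist v w
  dist-triangle u v w = dist-≤ (geodesic u v ∙ geodesic v w)

  dist-adj : ∀ {u w} v → adj G u w ≡ true → dist u v ≤ suc (dist w v)
  dist-adj v e = dist-≤ (cons e (geodesic _ v))

  dist-zero : ∀ {u v} → dist u v ≡ 0 → u ≡ v
  dist-zero {u} {v} eq with dist u v | geodesic u v
  dist-zero refl | _ | nil = refl

  dist-adj≡1 : ∀ {u v} → adj G u v ≡ true → dist u v ≡ 1
  dist-adj≡1 {u} {v} e with dist u v in eq | dist-adj v e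
  ... | 0           | _  = contradiction (dist-zero eq) (adj-≢ e)
  ... | 1           | _  = refl
  ... | suc (suc _) | le rewrite dist-refl v = contradiction le (λ { (s≤s ()) })

  dist-step : ∀ {u v k} → dist u v ≡ suc k → ∃[ w ] (adj G u w ≡ true × dist w v ≡ k)
  dist-step {u} {v} {k} eq with subst (Walk G u v) eq (geodesic u v)
  ... | cons {w = w} e p = w , e , ≤-antisym (dist-≤ p) (s≤s⁻¹ (subst (_≤ suc (dist w v)) eq (dist-adj v e)))

  dist<n : ∀ u v → dist u v < n
  dist<n u v = Fin.injective⇒≤ (at-injective (geodesic u v) (proj₂ (dist-isDist u v)))

  -- The source of every splitting of distances below: a walk from `A` to its complement contains an
  -- edge leaving `A`, and such an edge starts at `g`.
  gate : (A : Fin n → Set) → (∀ x → Dec (A x)) → ∀ g → (∀ {x y} → adj G x y ≡ true → A x → ¬ A y → x ≡ g) →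
         ∀ {x y} → A x → ¬ A y → dist x y ≡ dist x g + dist g y
  gate A A? g exit {x} {y} Ax ¬Ay = ≤-antisym (dist-triangle x g y) (through (geodesic x y) Ax)
    where
    through : ∀ {x k} → Walk G x y k → A x → dist x g + dist g y ≤ k
    through nil Ax = contradiction Ax ¬Ay
    through {x} (cons {w = w} e p) Ax with A? w
    ... | yes Aw = ≤-trans (+-monoˡ-≤ (dist g y) (dist-adj g e)) (s≤s (through p Aw))
    ... | no ¬Aw with exit e Ax ¬Aw
    ...   | refl rewrite dist-refl x = dist-≤ (cons e p)

-- Rotation along the cycle

rot : ∀ {k} → Fin (suc k) → ℕ → Fin (suc k)
rot i zero    = i
rot i (suc t) = next (rot i t)

toℕ-rot : ∀ {k} (i : Fin (suc k)) t → toℕ (rot i t) ≡ (t + toℕ i) % suc k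
toℕ-rot {k} i zero    = sym (m<n⇒m%n≡m (Fin.toℕ<n i))
toℕ-rot {k} i (suc t) = begin
  toℕ (next (rot i t))                                ≡⟨ toℕ-next (rot i t) ⟩
  suc (toℕ (rot i t)) % suc k                         ≡⟨ cong (λ a → suc a % suc k) (toℕ-rot i t) ⟩
  (1 + (t + toℕ i) % suc k) % suc k                   ≡⟨ %-distribˡ-+ 1 ((t + toℕ i) % suc k) (suc k) ⟩
  (1 % suc k + (t + toℕ i) % suc k % suc k) % suc k   ≡⟨ cong (λ a → (1 % suc k + a) % suc k) (m%n%n≡m%n (t + toℕ i) (suc k)) ⟩
  (1 % suc k + (t + toℕ i) % suc k) % suc k           ≡⟨ %-distribˡ-+ 1 (t + toℕ i) (suc k) ⟨
  suc (t + toℕ i) % suc k                             ∎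
  where open ≡-Reasoning

rot-+ : ∀ {k} (i : Fin (suc k)) s t → rot (rot i s) t ≡ rot i (t + s)
rot-+ i s zero    = refl
rot-+ i s (suc t) = cong next (rot-+ i s t)

rot-full : ∀ {k} (i : Fin (suc k)) → rot i (suc k) ≡ i
rot-full {k} i = Fin.toℕ-injective (trans (toℕ-rot i (suc k)) (trans (cong (_% suc k) (+-comm (suc k) (toℕ i)))
  (trans ([m+n]%n≡m%n (toℕ i) (suc k)) (m<n⇒m%n≡m (Fin.toℕ<n i)))))

-- After one step, `k` further steps complete a full turn and so undo it.
next-injective : ∀ {k} {i j : Fin (suc k)} → next i ≡ next j → i ≡ j
next-injective {k} {i} {j} eq = trans (back i) (trans (cong (λ h → rot h k) eq) (sym (back j)))
  where
  back : ∀ h → h ≡ rot (next h) k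
  back h = trans (sym (rot-full h)) (trans (cong (rot h) (+-comm 1 k)) (sym (rot-+ h 1 k)))

rot-surjective : ∀ {k} (i j : Fin (suc k)) → ∃[ t ] (t < suc k × rot i t ≡ j)
rot-surjective {k} i j with ≤-total (toℕ i) (toℕ j)
... | inj₁ i≤j = t , ≤-<-trans (m∸n≤m (toℕ j) (toℕ i)) (Fin.toℕ<n j) ,
    Fin.toℕ-injective (trans (toℕ-rot i t) (trans (cong (_% suc k) (m∸n+n≡m i≤j)) (m<n⇒m%n≡m (Fin.toℕ<n j))))
  where t = toℕ j ∸ toℕ i
... | inj₂ j≤i with toℕ i ≟ toℕ j
...   | yes i≡j = 0 , z<s , Fin.toℕ-injective i≡j
...   | no i≢j = t , t< , Fin.toℕ-injective (begin
      toℕ (rot i t)                   ≡⟨ toℕ-rot i t ⟩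
      (toℕ j + (suc k ∸ toℕ i) + toℕ i) % suc k   ≡⟨ cong (_% suc k) (+-assoc (toℕ j) (suc k ∸ toℕ i) (toℕ i)) ⟩
      (toℕ j + (suc k ∸ toℕ i + toℕ i)) % suc k   ≡⟨ cong (λ a → (toℕ j + a) % suc k) (m∸n+n≡m (<⇒≤ (Fin.toℕ<n i))) ⟩
      (toℕ j + suc k) % suc k         ≡⟨ [m+n]%n≡m%n (toℕ j) (suc k) ⟩
      toℕ j % suc k                   ≡⟨ m<n⇒m%n≡m (Fin.toℕ<n j) ⟩
      toℕ j                           ∎)
  where
  open ≡-Reasoning
  t = toℕ j + (suc k ∸ toℕ i)
  t< : t < suc k
  t< = lin 4 (λ i j d k → j :≤ i :⇒ d :+ i := k :⇒ con 1 :+ j :≤ i :⇒ ⊢ j :+ d :< k) (toℕ i) (toℕ j) (suc k ∸ toℕ i) (suc k)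
    j≤i (m∸n+n≡m (<⇒≤ (Fin.toℕ<n i))) (≤∧≢⇒< j≤i (i≢j ∘ sym))

rot-fixed : ∀ {k} (i : Fin (suc k)) t → t ≤ suc k → rot i t ≡ i → t ≡ 0 ⊎ t ≡ suc k
rot-fixed {k} i t t≤ eq with <-≤-connex (t + toℕ i) (suc k)
... | inj₁ lt = inj₁ (+-cancelʳ-≡ (toℕ i) t 0 (trans (sym (m<n⇒m%n≡m lt)) (trans (sym (toℕ-rot i t)) (cong toℕ eq))))
... | inj₂ ge = inj₂ (lin 4 (λ d t i k → d :+ k := t :+ i :⇒ d := i :⇒ ⊢ t := k) d t (toℕ i) (suc k) (m∸n+n≡m ge) d≡i)
  where
  d = t + toℕ i ∸ suc k
  d< : d < suc k
  d< = lin 4 (λ d t i k → d :+ k := t :+ i :⇒ t :≤ k :⇒ i :< k :⇒ ⊢ d :< k) d t (toℕ i) (suc k) (m∸n+n≡m ge) t≤ (Fin.toℕ<n i)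
  d≡i : d ≡ toℕ i
  d≡i = begin
    d                        ≡⟨ m<n⇒m%n≡m d< ⟨
    d % suc k                ≡⟨ [m+n]%n≡m%n d (suc k) ⟨
    (d + suc k) % suc k      ≡⟨ cong (_% suc k) (m∸n+n≡m ge) ⟩
    (t + toℕ i) % suc k      ≡⟨ toℕ-rot i t ⟨
    toℕ (rot i t)            ≡⟨ cong toℕ eq ⟩
    toℕ i                    ∎
    where open ≡-Reasoning

-- A record, so that SameCycle is not unfolded whenever a context is normalised.
record OnlyCycle {n : ℕ} (G : Graph n) (C : Cycle G) : Set where
  constructor only
  field same : ∀ C′ → SameCycle G C C′

-- Bridges, hanging trees and their distances

module Structure {n : ℕ} (G : Graph n) (conn : Connected G) (C : Cycle G) (uniq : OnlyCycle G C) where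

  open Walks G public
  open Metric G conn public

  V : Set
  V = Fin n

  K : ℕ
  K = 3 + Cycle.m C

  c : Fin K → V
  c = vs C

  c-adj : ∀ i → adj G (c i) (c (next i)) ≡ true
  c-adj i = subst (λ j → adj G (c i) (c j) ≡ true) (sym (next-mod i)) (Cycle.edges C i)

  -- Defined only as an edge off `C`; that it separates its ends is `no-bypass`.
  Bridge : V → V → Set
  Bridge u v = adj G u v ≡ true × isCEdge G C u v ≡ false

  OnCycle : V → Set
  OnCycle x = ∃[ i ] c i ≡ x

  OnCycle? : ∀ x → Dec (OnCycle x)
  OnCycle? x = Fin.any? (λ i → c i Fin.≟ x)

  edge-cases : ∀ {x y} → adj G x y ≡ true →
    Bridge x y ⊎ ∃[ i ] ((c i ≡ x × c (next i) ≡ y) ⊎ (c i ≡ y × c (next i) ≡ x))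
  edge-cases {x} {y} e with isCEdge G C x y in eq
  ... | true  = inj₂ (isCEdge-elim G C eq)
  ... | false = inj₁ (e , refl)

  off-bridge : ∀ {x y} → ¬ OnCycle x → adj G x y ≡ true → Bridge x y
  off-bridge off e with edge-cases e
  ... | inj₁ b                = b
  ... | inj₂ (i , inj₁ (p , _)) = contradiction (i , p) off
  ... | inj₂ (i , inj₂ (_ , p)) = contradiction (next i , p) off

  not-cycle-edge : ∀ {u v} i → Bridge u v → ¬ (c i ≡ u × c (next i) ≡ v)
  not-cycle-edge i (_ , b) (p , q) with trans (sym b) (isCEdge-intro G C i p q)
  ... | ()

  not-cycle-edgeʳ : ∀ {u v} i → Bridge u v → ¬ (c i ≡ v × c (next i) ≡ u)
  not-cycle-edgeʳ i (_ , b) (p , q) with trans (sym b) (isCEdge-introʳ G C i p q)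
  ... | ()

  bridge-sym : ∀ {u v} → Bridge u v → Bridge v u
  bridge-sym b@(e , _) with edge-cases (adj-sym e)
  ... | inj₁ b′              = b′
  ... | inj₂ (i , inj₁ pq) = contradiction pq (not-cycle-edgeʳ i b)
  ... | inj₂ (i , inj₂ pq) = contradiction pq (not-cycle-edge i b)

  private
    isPair : V → V → V → V → Bool
    isPair u v x y = does ((x Fin.≟ u) ×-dec (y Fin.≟ v))

    removed : V → V → V → V → Bool
    removed u v x y = isPair u v x y ∨ isPair u v y x

  _∖_,_ : (H : Graph n) → V → V → Graph n
  H ∖ u , v = record
    { adj    = λ x y → adj H x y ∧ not (removed u v x y)
    ; sym    = λ x y → cong₂ _∧_ (Graph.sym H x y) (cong not (∨-comm (isPair u v x y) (isPair u v y x)))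
    ; irrefl = λ x → cong (_∧ not (removed u v x x)) (Graph.irrefl H x)
    }

  private
    ∖-adj : ∀ {u v x y} → adj G x y ≡ true → ¬ (x ≡ u × y ≡ v) → ¬ (y ≡ u × x ≡ v) → adj (G ∖ u , v) x y ≡ true
    ∖-adj {u} {v} {x} {y} e p q = cong₂ _∧_ e (cong₂ (λ a b → not (a ∨ b))
      (dec-false ((x Fin.≟ u) ×-dec (y Fin.≟ v)) p) (dec-false ((y Fin.≟ u) ×-dec (x Fin.≟ v)) q))

    ∖-removed : ∀ u v → adj (G ∖ u , v) u v ≡ false
    ∖-removed u v = trans (cong (λ a → adj G u v ∧ not (a ∨ isPair u v v u)) (dec-true ((u Fin.≟ u) ×-dec (v Fin.≟ v)) (refl , refl)))
      (∧-zeroʳ (adj G u v))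

  -- A second route between the ends of a bridge would close up to a cycle other than C.
  no-bypass : ∀ {u v} → Bridge u v → ∀ {k} → ¬ Walk (G ∖ u , v) u v k
  no-bypass {u} {v} (e , b) p with Walks.shortest (G ∖ u , v) p
  ... | 0 , nil , _ = adj-≢ e refl
  ... | 1 , cons e′ nil , _ = contradiction (trans (sym e′) (∖-removed u v)) λ ()
  ... | suc (suc d) , shortest with closeWalk G (G ∖ u , v) (proj₁ ∘ ∧-true) shortest (adj-sym e)
  ...   | C′ , on with trans (sym on) (trans (sym (OnlyCycle.same uniq C′ u v)) b)
  ...     | ()

  private
    -- Geodesics from x to the nearer of two vertices t, t′ avoid any edge between them.
    avoiding : ∀ (H : Graph n) {t t′} → t ≢ t′ →
      (∀ {x w} → adj G x w ≡ true → x ≢ t → x ≢ t′ → adj H x w ≡ true) →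
      ∀ k {x} → dist x t ≡ k → dist x t ≤ dist x t′ → Walk H x t k
    avoiding H t≢t′ keep zero eq _ with dist-zero eq
    ... | refl = nil
    avoiding H {t} {t′} t≢t′ keep (suc k) {x} eq le with dist-step eq
    ... | w , e , eq′ = cons (keep e x≢t x≢t′) (avoiding H t≢t′ keep k eq′ le′)
      where
      x≢t : x ≢ t
      x≢t refl = contradiction (trans (sym eq) (dist-refl x)) λ ()
      x≢t′ : x ≢ t′
      x≢t′ refl = contradiction (subst₂ _≤_ eq (dist-refl x) le) λ ()
      le′ : dist w t ≤ dist w t′
      le′ = lin 5 (λ a b a′ b′ k → a := con 1 :+ k :⇒ a :≤ b :⇒ a′ := k :⇒ b :≤ con 1 :+ b′ :⇒ ⊢ a′ :≤ b′)
        (dist x t) (dist x t′) (dist w t) (dist w t′) k eq le eq′ (dist-adj t′ e)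

  -- For a bridge this is the side of `u` once the edge is removed, expressed by distances so that
  -- it is decidable.
  Near : V → V → V → Set
  Near u v x = dist x u < dist x v

  Near? : ∀ u v x → Dec (Near u v x)
  Near? u v x = dist x u <? dist x v

  Near-self : ∀ {u v} → u ≢ v → Near u v u
  Near-self {u} {v} u≢v = subst (_< dist u v) (sym (dist-refl u)) (n≢0⇒n>0 (u≢v ∘ dist-zero))

  Near-far : ∀ {u v} → ¬ Near u v v
  Near-far {u} {v} lt = n≮0 (subst (dist v u <_) (dist-refl v) lt)

  -- Otherwise a geodesic from `x` to `u`, the edge from `x` to `y`, and a geodesic from `y` to `v`
  -- would join the ends of the bridge without using it.
  Near-exit : ∀ {u v x y} → Bridge u v → Near u v x → adj G x y ≡ true → ¬ Near u v y → x ≡ u × y ≡ v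
  Near-exit {u} {v} {x} {y} b near e far with (x Fin.≟ u) ×-dec (y Fin.≟ v)
  ... | yes uv = uv
  ... | no ¬uv = ⊥-elim (no-bypass b (Walks._∙_ H (Walks.reverse H toU) (cons e′ toV)))
    where
    H = G ∖ u , v
    toU : Walk H x u (dist x u)
    toU = avoiding H (adj-≢ (proj₁ b)) (λ e p q → ∖-adj e (p ∘ proj₁) (q ∘ proj₂)) _ refl (<⇒≤ near)
    toV : Walk H y v (dist y v)
    toV = avoiding H (adj-≢ (proj₁ b) ∘ sym) (λ e p q → ∖-adj e (q ∘ proj₁) (p ∘ proj₂)) _ refl (≮⇒≥ far)
    e′ : adj H x y ≡ true
    e′ = ∖-adj e ¬uv (λ (_ , x≡v) → Near-far (subst (Near u v) x≡v near))

  -- `gate` applies from both sides: the side of `u` is left only at `u`, the other side only at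
  -- `v`.
  Near-gate : ∀ {u v x y} → Bridge u v → Near u v x → ¬ Near u v y → dist x y ≡ dist x u + suc (dist v y)
  Near-gate {u} {v} {x} {y} b near far = begin
    dist x y                              ≡⟨ gate (Near u v) (Near? u v) u (λ e p q → proj₁ (Near-exit b p e q)) near far ⟩
    dist x u + dist u y                   ≡⟨ cong (dist x u +_) (dist-sym u y) ⟩
    dist x u + dist y u                   ≡⟨ cong (dist x u +_) out ⟩
    dist x u + (dist y v + dist v u)      ≡⟨ cong (λ d → dist x u + (dist y v + d)) (dist-adj≡1 (adj-sym (proj₁ b))) ⟩
    dist x u + (dist y v + 1)             ≡⟨ cong (dist x u +_) (+-comm (dist y v) 1) ⟩
    dist x u + suc (dist y v)             ≡⟨ cong (λ d → dist x u + suc d) (dist-sym y v) ⟩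
    dist x u + suc (dist v y)             ∎
    where
    open ≡-Reasoning
    out : dist y u ≡ dist y v + dist v u
    out = gate (λ z → ¬ Near u v z) (λ z → ¬? (Near? u v z)) v
      (λ e p q → proj₂ (Near-exit b (decidable-stable (Near? u v _) q) (adj-sym e) p))
      far (λ ¬near → ¬near (Near-self (adj-≢ (proj₁ b))))

  near-dist : ∀ {u v x} → Bridge u v → Near u v x → dist x v ≡ suc (dist x u)
  near-dist {u} {v} {x} b near = trans (Near-gate b near (Near-far {u} {v}))
    (trans (cong (λ d → dist x u + suc d) (dist-refl v)) (+-comm (dist x u) 1))

  far-dist : ∀ {u v x} → Bridge u v → ¬ Near u v x → dist x u ≡ suc (dist x v)
  far-dist {u} {v} {x} b far = trans (dist-sym x u) (trans (Near-gate b (Near-self (adj-≢ (proj₁ b))) far)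
    (trans (cong (_+ suc (dist v x)) (dist-refl u)) (cong suc (dist-sym v x))))

  cycle-induction : (P : Fin K → Set) → (∀ i → P i → P (next i)) → ∀ {i} → P i → ∀ j → P j
  cycle-induction P step {i} p j = let t , _ , eq = rot-surjective i j in subst P eq (go t)
    where
    go : ∀ t → P (rot i t)
    go zero    = p
    go (suc t) = step _ (go t)

  -- A cycle edge is not the bridge, so no step along `C` changes sides. This gives every bridge a
  -- direction towards `C`.
  cycle-one-side : ∀ {u v} → Bridge u v → ∀ {i} → Near u v (c i) → ∀ j → Near u v (c j)
  cycle-one-side {u} {v} b = cycle-induction (λ i → Near u v (c i)) step
    where
    step : ∀ i → Near u v (c i) → Near u v (c (next i))
    step i near = decidable-stable (Near? u v _) λ far →
      not-cycle-edge i b (Near-exit b near (c-adj i) far)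

  -- The edge from `x` leads up to `z`. The drop in height is recorded for all cycle vertices, so
  -- that it can be read off at any root.
  record Child (x z : V) : Set where
    constructor child
    field
      bridge : Bridge x z
      lower  : ∀ i → dist (c i) x ≡ suc (dist (c i) z)
  open Child public

  Child-adj : ∀ {x z} → Child x z → adj G x z ≡ true
  Child-adj ch = proj₁ (bridge ch)

  Child-asym : ∀ {x z} → Child x z → ¬ Child z x
  Child-asym {x} {z} p q = lin 2 (λ a b → a := con 1 :+ b :⇒ b := con 1 :+ a :⇒ ⊢ :⊥)
    (dist (c zero) x) (dist (c zero) z) (lower p zero) (lower q zero)

  Child-off : ∀ {x z} → Child x z → ¬ OnCycle x
  Child-off ch (i , refl) = contradiction (trans (sym (dist-refl (c i))) (lower ch i)) λ ()

  Child-cycle-far : ∀ {x z} → Child x z → ∀ i → ¬ Near x z (c i)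
  Child-cycle-far {x} {z} ch i near = lin 2 (λ a b → a :< b :⇒ a := con 1 :+ b :⇒ ⊢ :⊥)
    (dist (c i) x) (dist (c i) z) near (lower ch i)

  bridge-Child : ∀ {u v} → Bridge u v → Child u v ⊎ Child v u
  bridge-Child {u} {v} b with Near? u v (c zero)
  ... | yes near = inj₂ (child (bridge-sym b) (λ i → near-dist b (cycle-one-side b near i)))
  ... | no far   = inj₁ (child b (λ i → far-dist b (λ near → far (cycle-one-side b near zero))))

  -- A second parent on the side of `x` would reach the cycle only through `x`, although it is
  -- nearer to the cycle than `x`.
  parent-unique : ∀ {x z z′} → Child x z → Child x z′ → z ≡ z′
  parent-unique {x} {z} {z′} p q = sym (proj₂ (Near-exit (bridge p) (Near-self (adj-≢ (Child-adj p))) (Child-adj q) far))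
    where
    far : ¬ Near x z z′
    far near = lin 6 (λ a b d e f g → a := b :+ con 1 :+ d :⇒ e := con 1 :+ d :⇒ e := con 1 :+ f :⇒ f := a :⇒ g := d :⇒ ⊢ :⊥)
      (dist z′ (c zero)) (dist z′ x) (dist z (c zero)) (dist (c zero) x) (dist (c zero) z′) (dist (c zero) z)
      (trans (Near-gate (bridge p) near (Child-cycle-far p zero)) (+-suc′ (dist z′ x) (dist z (c zero))))
      (trans (lower p zero) (cong suc (dist-sym (c zero) z))) (lower q zero) (dist-sym (c zero) z′) (dist-sym (c zero) z)
      where
      +-suc′ : ∀ a b → a + suc b ≡ a + 1 + b
      +-suc′ a b = sym (+-assoc a 1 b)

  other-child : ∀ {x z w} → Child x z → adj G x w ≡ true → w ≢ z → Child w x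
  other-child ch e w≢z with bridge-Child (off-bridge (Child-off ch) e)
  ... | inj₁ up   = contradiction (parent-unique up ch) w≢z
  ... | inj₂ down = down

  cycle-child : ∀ {z w} → OnCycle z → Bridge z w → Child w z
  cycle-child on b with bridge-Child b
  ... | inj₁ up   = contradiction on (Child-off up)
  ... | inj₂ down = down

  -- Membership in the tree at `c i` as a condition on distances: from every cycle vertex some
  -- geodesic to `x` passes through `c i`.
  In : V → Fin K → Set
  In x i = ∀ j → dist (c j) x ≡ dist (c j) (c i) + dist (c i) x

  In? : ∀ x i → Dec (In x i)
  In? x i = Fin.all? (λ j → dist (c j) x ≟ dist (c j) (c i) + dist (c i) x)

  In-c : ∀ i → In (c i) i
  In-c i j = sym (trans (cong (dist (c j) (c i) +_) (dist-refl (c i))) (+-identityʳ _))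

  In-unique : ∀ {x i j} → In x i → In x j → i ≡ j
  In-unique {x} {i} {j} p q = Cycle.inj C (dist-zero
    (lin 4 (λ a b s t → b := s :+ a :⇒ a := t :+ b :⇒ ⊢ t := con 0)
      (dist (c i) x) (dist (c j) x) (dist (c j) (c i)) (dist (c i) (c j)) (p j) (q i)))

  In-down : ∀ {x z i} → Child x z → In z i → In x i
  In-down {x} {z} {i} ch p j = trans (lower ch j) (trans (cong suc (p j))
    (trans (sym (+-suc _ _)) (cong (dist (c j) (c i) +_) (sym (lower ch i)))))

  In-up : ∀ {x z i} → Child x z → In x i → In z i
  In-up {x} {z} {i} ch p j = suc-injective (trans (sym (lower ch j)) (trans (p j)
    (trans (cong (dist (c j) (c i) +_) (lower ch i)) (+-suc _ _))))

  In-bridge : ∀ {x y i} → Bridge x y → In x i → In y i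
  In-bridge b p with bridge-Child b
  ... | inj₁ ch = In-up ch p
  ... | inj₂ ch = In-down ch p

  -- Read along a walk to `c zero`: a bridge keeps the tree, and an end of a cycle edge is its own
  -- root.
  root : ∀ x → ∃[ i ] In x i
  root x = go (geodesic x (c zero))
    where
    go : ∀ {x k} → Walk G x (c zero) k → ∃[ i ] In x i
    go nil = zero , In-c zero
    go (cons e p) with edge-cases e
    ... | inj₁ b                       = let i , q = go p in i , In-bridge (bridge-sym b) q
    ... | inj₂ (i , inj₁ (refl , _)) = i , In-c i
    ... | inj₂ (i , inj₂ (_ , refl)) = next i , In-c (next i)

  In-off : ∀ {x i} → In x i → x ≢ c i → ¬ OnCycle x
  In-off p x≢ (j , refl) = x≢ (cong c (In-unique (In-c j) p))

  parent : ∀ {x} → ¬ OnCycle x → ∃[ z ] Child x z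
  parent {x} off with root x
  ... | i , p with dist x (c i) in eq
  ...   | zero  = contradiction (i , sym (dist-zero eq)) off
  ...   | suc k with dist-step eq
  ...     | w , e , eq′ with bridge-Child (off-bridge off e)
  ...       | inj₁ up   = w , up
  -- A step towards the root cannot lead to a child, which is farther from the root.
  ...       | inj₂ down = ⊥-elim (lin 5 (λ a b k a′ b′ → a := con 1 :+ k :⇒ b := k :⇒ b′ := con 1 :+ a′ :⇒ a := a′ :⇒ b := b′ :⇒ ⊢ :⊥)
      (dist x (c i)) (dist w (c i)) k (dist (c i) x) (dist (c i) w) eq eq′ (lower down i) (dist-sym x (c i)) (dist-sym w (c i)))

  In-exit : ∀ {x y i} → adj G x y ≡ true → In x i → ¬ In y i → x ≡ c i
  In-exit e p q with edge-cases e
  ... | inj₁ b                       = contradiction (In-bridge b p) q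
  ... | inj₂ (j , inj₁ (refl , _)) = cong c (In-unique (In-c j) p)
  ... | inj₂ (j , inj₂ (_ , refl)) = cong c (In-unique (In-c (next j)) p)

  dist-trees : ∀ {x y i j} → In x i → In y j → i ≢ j → dist x y ≡ dist (c i) x + (dist (c i) (c j) + dist (c j) y)
  dist-trees {x} {y} {i} {j} p q i≢j = begin
    dist x y                              ≡⟨ gate (λ x → In x i) (λ x → In? x i) (c i) In-exit p (λ q′ → i≢j (In-unique q′ q)) ⟩
    dist x (c i) + dist (c i) y           ≡⟨ cong₂ _+_ (dist-sym x (c i)) (q i) ⟩
    dist (c i) x + (dist (c i) (c j) + dist (c j) y) ∎
    where open ≡-Reasoning

  dist-tree-≤ : ∀ x y i → dist x y ≤ dist (c i) x + dist (c i) y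
  dist-tree-≤ x y i = subst (λ d → dist x y ≤ d + dist (c i) y) (dist-sym x (c i)) (dist-triangle x (c i) y)

  Near-child : ∀ {x y u v} → Child x y → Child u v → Near u v y → Near u v x
  Near-child {x} {y} {u} {v} ch ch′ near = decidable-stable (Near? u v x) λ far → absurd (Near-exit (bridge ch′) near (adj-sym (Child-adj ch)) far)
    where
    absurd : y ≡ u × x ≡ v → ⊥
    absurd (refl , refl) = Child-asym ch ch′

  -- z is the last common ancestor of x and y.
  record Fork (x y : V) : Set where
    field
      z x′ y′ : V
      x′≢y′   : x′ ≢ y′
      childˣ  : Child x′ z
      childʸ  : Child y′ z
      nearˣ   : Near x′ z x
      nearʸ   : Near y′ z y

  -- Equal heights let both vertices climb in step until their parents coincide, at the latest in
  -- the root.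
  fork : ∀ {x y i} h → In x i → In y i → dist (c i) x ≡ h → dist (c i) y ≡ h → x ≢ y → Fork x y
  fork zero    p q eqx eqy x≢y = contradiction (trans (sym (dist-zero eqx)) (dist-zero eqy)) x≢y
  fork {x} {y} {i} (suc h) p q eqx eqy x≢y with parent (off p eqx) | parent (off q eqy)
    where
    off : ∀ {x} → In x i → dist (c i) x ≡ suc h → ¬ OnCycle x
    off p eq = In-off p λ { refl → contradiction (trans (sym (dist-refl (c i))) eq) λ () }
  ... | x′ , chx | y′ , chy with x′ Fin.≟ y′
  ...   | yes refl = record { x′≢y′ = x≢y ; childˣ = chx ; childʸ = chy
      ; nearˣ = Near-self (adj-≢ (Child-adj chx)) ; nearʸ = Near-self (adj-≢ (Child-adj chy)) }
  ...   | no x′≢y′ = record { x′≢y′ = F.x′≢y′ ; childˣ = F.childˣ ; childʸ = F.childʸ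
      ; nearˣ = Near-child chx F.childˣ F.nearˣ ; nearʸ = Near-child chy F.childʸ F.nearʸ }
      where
      module F = Fork (fork {i = i} h (In-up chx p) (In-up chy q) (suc-injective (trans (sym (lower chx i)) eqx))
        (suc-injective (trans (sym (lower chy i)) eqy)) x′≢y′)

  siblings-disjoint : ∀ {z x y s} → x ≢ y → Child x z → Child y z → Near x z s → ¬ Near y z s
  siblings-disjoint {z} {x} {y} {s} x≢y chx chy nx ny =
    lin 4 (λ a b d e → a := b :+ (con 1 :+ d) :⇒ b := a :+ (con 1 :+ e) :⇒ ⊢ :⊥) (dist s y) (dist s x) (dist z y) (dist z x)
      (Near-gate (bridge chx) nx (far x≢y chx chy)) (Near-gate (bridge chy) ny (far (x≢y ∘ sym) chy chx))
    where
    far : ∀ {x y} → x ≢ y → Child x z → Child y z → ¬ Near x z y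
    far x≢y chx chy near = x≢y (sym (dist-zero (n<1⇒n≡0 (subst (_ <_) (dist-adj≡1 (Child-adj chy)) near))))

  height-below : ∀ {z x y} i → Child x z → Near x z y → dist (c i) y ≡ dist y x + dist (c i) x
  height-below {z} {x} {y} i ch near = begin
    dist (c i) y                       ≡⟨ dist-sym (c i) y ⟩
    dist y (c i)                       ≡⟨ Near-gate (bridge ch) near (Child-cycle-far ch i) ⟩
    dist y x + suc (dist z (c i))      ≡⟨ cong (λ d → dist y x + suc d) (dist-sym z (c i)) ⟩
    dist y x + suc (dist (c i) z)      ≡⟨ cong (dist y x +_) (lower ch i) ⟨
    dist y x + dist (c i) x            ∎
    where open ≡-Reasoning

  -- To reach `s`, `y` must climb to `z` and descend into the branch of `x`; beyond the equal climb
  -- this costs the two edges at `z`. A gap of two is needed because passing to edges may absorb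
  -- one.
  fork-dist : ∀ {z x′ y′ x y s} i → x′ ≢ y′ → Child x′ z → Child y′ z → Near x′ z x → Near y′ z y →
              dist (c i) x ≡ dist (c i) y → Near x′ z s → 2 + dist x s ≤ dist y s
  fork-dist {z} {x′} {y′} {x} {y} {s} i x′≢y′ chx chy nx ny eq ns =
    lin 10 (λ hx hy hx′ hy′ hz dx dy xs ys sx → hx := dx :+ hx′ :⇒ hy := dy :+ hy′ :⇒ hx′ := con 1 :+ hz :⇒ hy′ := con 1 :+ hz :⇒
        hx := hy :⇒ ys := dy :+ (con 2 :+ sx) :⇒ xs :≤ dx :+ sx :⇒ ⊢ con 2 :+ xs :≤ ys)
      (dist (c i) x) (dist (c i) y) (dist (c i) x′) (dist (c i) y′) (dist (c i) z) (dist x x′) (dist y y′) (dist x s) (dist y s) (dist s x′)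
      (height-below i chx nx) (height-below i chy ny) (lower chx i) (lower chy i) eq
      (trans (Near-gate (bridge chy) ny (siblings-disjoint x′≢y′ chx chy ns))
        (cong (λ d → dist y y′ + suc d) (trans (dist-sym z s) (near-dist (bridge chx) ns))))
      (subst (λ d → dist x s ≤ dist x x′ + d) (dist-sym x′ s) (dist-triangle x x′ s))

-- Distances and geodesic triples on the cycle

module CycleMetric {n : ℕ} (G : Graph n) (conn : Connected G) (C : Cycle G) (uniq : OnlyCycle G C) where

  open Structure G conn C uniq

  cdist : Fin K → Fin K → ℕ
  cdist i j = dist (c i) (c j)

  -- The distance of position t from position 0 along a closed track of length L.
  Around : ℕ → ℕ → ℕ → Set
  Around L t d = (d ≡ t × t + t ≤ L) ⊎ (d + t ≡ L × L ≤ t + t)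

  cdist-≤ : ∀ a t → cdist a (rot a t) ≤ t
  cdist-≤ a zero    = ≤-reflexive (dist-refl (c a))
  cdist-≤ a (suc t) = ≤-trans (dist-triangle (c a) (c (rot a t)) _)
    (≤-trans (+-mono-≤ (cdist-≤ a t) (≤-reflexive (dist-adj≡1 (c-adj (rot a t))))) (≤-reflexive (+-comm t 1)))

  walk-around : ∀ {x a m} t → In x (rot a t) → t ≤ K → Walk G x (c a) m → t ≤ m ⊎ K ≤ t + m
  walk-around {a = a} t p t≤K nil = Sum.map (λ eq → ≤-reflexive eq) (λ eq → ≤-trans (≤-reflexive (sym eq)) (m≤m+n t 0))
    (rot-fixed a t t≤K (In-unique p (In-c a)))
  walk-around {x} {a} {suc m} t p t≤K (cons {w = y} e w) = step (edge-cases e) t p t≤K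
    where
    step : Bridge x y ⊎ ∃[ j ] ((c j ≡ x × c (next j) ≡ y) ⊎ (c j ≡ y × c (next j) ≡ x)) →
           ∀ t → In x (rot a t) → t ≤ K → t ≤ suc m ⊎ K ≤ t + suc m
    step (inj₁ b) t p t≤K = Sum.map m≤n⇒m≤1+n (λ le → ≤-trans le (+-monoʳ-≤ t (n≤1+n m))) (walk-around t (In-bridge b p) t≤K w)
    step (inj₂ (j , inj₁ (cj≡x , cj⁺≡y))) t p t≤K = [ forward , (λ { refl → inj₂ (m≤m+n K (suc m)) }) ]′ (m≤n⇒m<n∨m≡n t≤K)
      where
      In-y : In y (rot a (suc t))
      In-y = subst₂ In cj⁺≡y (cong next (In-unique (In-c j) (subst (λ z → In z _) (sym cj≡x) p))) (In-c (next j))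
      forward : t < K → t ≤ suc m ⊎ K ≤ t + suc m
      forward t<K = Sum.map (λ le → ≤-trans (n≤1+n t) (m≤n⇒m≤1+n le)) (λ le → ≤-trans le (≤-reflexive (sym (+-suc t m))))
        (walk-around (suc t) In-y t<K w)
    step (inj₂ (j , inj₂ _)) zero p t≤K = inj₁ z≤n
    step (inj₂ (j , inj₂ (cj≡y , cj⁺≡x))) (suc t) p t≤K = Sum.map s≤s (λ le → ≤-trans le (+-mono-≤ (n≤1+n t) (n≤1+n m)))
      (walk-around t In-y (≤-trans (n≤1+n t) t≤K) w)
      where
      In-y : In y (rot a t)
      In-y = subst₂ In cj≡y (next-injective (In-unique (In-c (next j)) (subst (λ z → In z _) (sym cj⁺≡x) p))) (In-c j)

  cdist-around : ∀ a t → t ≤ K → Around K t (cdist (rot a t) a)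
  cdist-around a t t≤K = cases (walk-around t (In-c (rot a t)) t≤K (geodesic (c (rot a t)) (c a)))
    where
    d = cdist (rot a t) a
    le : d ≤ t
    le = subst (_≤ t) (dist-sym (c a) (c (rot a t))) (cdist-≤ a t)
    ge : d + t ≤ K
    ge = subst₂ (λ b l → dist (c (rot a t)) (c b) + t ≤ l) closed (m∸n+n≡m t≤K) (+-monoˡ-≤ t (cdist-≤ (rot a t) (K ∸ t)))
      where
      closed : rot (rot a t) (K ∸ t) ≡ a
      closed = trans (rot-+ a t (K ∸ t)) (trans (cong (rot a) (m∸n+n≡m t≤K)) (rot-full a))
    cases : t ≤ d ⊎ K ≤ t + d → Around K t d
    cases (inj₁ t≤d) = inj₁ (≤-antisym le t≤d , lin 3 (λ d t k → t :≤ d :⇒ d :+ t :≤ k :⇒ ⊢ t :+ t :≤ k) d t K t≤d ge)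
    cases (inj₂ k≤)  = inj₂ (lin 3 (λ d t k → d :+ t :≤ k :⇒ k :≤ t :+ d :⇒ ⊢ d :+ t := k) d t K ge k≤ ,
                             lin 3 (λ d t k → d :≤ t :⇒ k :≤ t :+ d :⇒ ⊢ k :≤ t :+ t) d t K le k≤)

  edist : Fin K → Fin K → ℕ
  edist i a = cdist i a ⊓ cdist (next i) a

  -- The edge at `t` joins positions `t` and `t + 1`, so its distance from `a` is the minimum of `t`
  -- and `K - 1 - t`: edges behave like points on a track shorter by one, and `mirrored` covers
  -- both.
  edist-around : ∀ a t → t < K → Around (pred K) t (edist (rot a t) a)
  edist-around a t t<K with cdist-around a t (<⇒≤ t<K) | cdist-around a (suc t) t<K | ≤-total (cdist (rot a t) a) (cdist (rot a (suc t)) a)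
  ... | p | q | inj₁ le rewrite m≤n⇒m⊓n≡m le = lower-end p q
    where
    d = cdist (rot a t) a
    d′ = cdist (rot a (suc t)) a
    lower-end : Around K t d → Around K (suc t) d′ → Around (pred K) t d
    lower-end (inj₁ (eq , h)) (inj₁ (eq′ , h′)) = inj₁ (eq , lin 2 (λ t k → con 2 :+ t :+ t :≤ con 1 :+ k :⇒ ⊢ t :+ t :≤ k) t (pred K) (subst (λ s → suc s ≤ K) (+-suc t t) h′))
    lower-end (inj₁ (eq , h)) (inj₂ (eq′ , h′)) = inj₁ (eq ,
      lin 4 (λ d d′ t k → d := t :⇒ d :≤ d′ :⇒ d′ :+ (con 1 :+ t) := con 1 :+ k :⇒ ⊢ t :+ t :≤ k) d d′ t (pred K) eq le eq′)
    lower-end (inj₂ (eq , h)) (inj₁ (eq′ , h′)) = ⊥-elim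
      (lin 2 (λ t k → k :≤ t :+ t :⇒ con 1 :+ t :+ (con 1 :+ t) :≤ k :⇒ ⊢ :⊥) t K h h′)
    lower-end (inj₂ (eq , h)) (inj₂ (eq′ , h′)) = ⊥-elim
      (lin 4 (λ d d′ t k → d :+ t := k :⇒ d :≤ d′ :⇒ d′ :+ (con 1 :+ t) := k :⇒ ⊢ :⊥) d d′ t K eq le eq′)
  ... | p | q | inj₂ ge rewrite m≥n⇒m⊓n≡n ge = upper-end p q
    where
    d = cdist (rot a t) a
    d′ = cdist (rot a (suc t)) a
    upper-end : Around K t d → Around K (suc t) d′ → Around (pred K) t d′
    upper-end (inj₁ (eq , h)) (inj₁ (eq′ , h′)) = ⊥-elim
      (lin 3 (λ d d′ t → d := t :⇒ d′ := con 1 :+ t :⇒ d′ :≤ d :⇒ ⊢ :⊥) d d′ t eq eq′ ge)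
    upper-end (inj₂ (eq , h)) (inj₁ (eq′ , h′)) = ⊥-elim
      (lin 2 (λ t k → k :≤ t :+ t :⇒ con 1 :+ t :+ (con 1 :+ t) :≤ k :⇒ ⊢ :⊥) t K h h′)
    upper-end (inj₁ (eq , h)) (inj₂ (eq′ , h′)) = inj₂ (
      lin 3 (λ d t k → d :+ (con 1 :+ t) := con 1 :+ k :⇒ ⊢ d :+ t := k) d′ t (pred K) eq′ ,
      lin 4 (λ d d′ t k → d :+ (con 1 :+ t) := con 1 :+ k :⇒ d′ := t :⇒ d :≤ d′ :⇒ ⊢ k :≤ t :+ t) d′ d t (pred K) eq′ eq ge)
    upper-end (inj₂ (eq , h)) (inj₂ (eq′ , h′)) = inj₂ (
      lin 3 (λ d t k → d :+ (con 1 :+ t) := con 1 :+ k :⇒ ⊢ d :+ t := k) d′ t (pred K) eq′ ,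
      lin 2 (λ t k → con 1 :+ k :≤ t :+ t :⇒ ⊢ k :≤ t :+ t) t (pred K) h)

  rot-injective : ∀ a {s t} → s < K → t < K → rot a s ≡ rot a t → s ≡ t
  rot-injective a {s} {t} s<K t<K eq = [ (λ s≤t → ordered s≤t t<K eq) , (λ t≤s → sym (ordered t≤s s<K (sym eq))) ]′ (≤-total s t)
    where
    ordered : ∀ {s t} → s ≤ t → t < K → rot a s ≡ rot a t → s ≡ t
    ordered {s} {t} s≤t t<K eq with rot-fixed (rot a s) (t ∸ s) (≤-trans (m∸n≤m t s) (<⇒≤ t<K))
                                     (trans (rot-+ a s (t ∸ s)) (trans (cong (rot a) (m∸n+n≡m s≤t)) (sym eq)))
    ... | inj₁ z = ≤-antisym s≤t (m∸n≡0⇒m≤n z)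
    ... | inj₂ f = contradiction (≤-trans (≤-reflexive (sym f)) (m∸n≤m t s)) (<⇒≱ t<K)

  rot-wrap : ∀ a {s t} → s < K + K → t < K → rot a s ≡ rot a t → s ≡ t ⊎ s ≡ t + K
  rot-wrap a {s} {t} s<2K t<K eq with <-≤-connex s K
  ... | inj₁ s<K = inj₁ (rot-injective a s<K t<K eq)
  ... | inj₂ K≤s = inj₂ (trans (sym (m∸n+n≡m K≤s)) (cong (_+ K) (rot-injective a r<K t<K eq′)))
    where
    r = s ∸ K
    r<K : r < K
    r<K = lin 3 (λ r s k → r :+ k := s :⇒ s :< k :+ k :⇒ ⊢ r :< k) r s K (m∸n+n≡m K≤s) s<2K
    eq′ : rot a r ≡ rot a t
    eq′ = trans (cong (λ b → rot b r) (sym (rot-full a))) (trans (rot-+ a K r) (trans (cong (rot a) (m∸n+n≡m K≤s)) eq))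

  -- Two items at the same distance from a are mirror images about a, so two items at the same
  -- distances from two points of the cycle force these points to be antipodal.
  mirrored : ∀ {L} (f : Fin K → Fin K → ℕ) → (∀ a t → t < K → Around L t (f (rot a t) a)) →
    ∀ a p {i j} → 0 < p → p < K → i ≢ j → f i a ≡ f j a → f i (rot a p) ≡ f j (rot a p) → p + p ≡ K
  mirrored {L} f around a p {i} {j} 0<p p<K i≢j eqa eqb
    with rot-surjective a i | rot-surjective a j | rot-surjective (rot a p) i | rot-surjective (rot a p) j
  ... | t , t<K , at | u , u<K , au | t′ , t′<K , bt | u′ , u′<K , bu =
    antipodal (position t<K t′<K at bt) (position u<K u′<K au bu)
    where
    mirror : ∀ b {t u} → t < K → u < K → rot b t ≡ i → rot b u ≡ j → f i b ≡ f j b → t + u ≡ L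
    mirror b {t} {u} t<K u<K refl refl eq with around b t t<K | around b u u<K
    ... | inj₁ (p , _) | inj₁ (q , _) = contradiction (cong (rot b) (trans (sym p) (trans eq q))) i≢j
    ... | inj₁ (p , _) | inj₂ (q , _) = trans (cong (_+ u) (trans (sym p) eq)) q
    ... | inj₂ (p , _) | inj₁ (q , _) = trans (+-comm t u) (trans (cong (_+ t) (trans (sym q) (sym eq))) p)
    ... | inj₂ (p , _) | inj₂ (q , _) =
      contradiction (cong (rot b) (+-cancelˡ-≡ (f (rot b t) b) t u (trans p (trans (sym q) (cong (_+ u) (sym eq)))))) i≢j
    position : ∀ {t t′ h} → t < K → t′ < K → rot a t ≡ h → rot (rot a p) t′ ≡ h → t′ + p ≡ t ⊎ t′ + p ≡ t + K
    position {t} {t′} t<K t′<K eq eq′ = rot-wrap a (+-mono-< t′<K p<K) t<K (trans (sym (rot-+ a p t′)) (trans eq′ (sym eq)))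
    s : t + u ≡ L
    s = mirror a t<K u<K at au eqa
    s′ : t′ + u′ ≡ L
    s′ = mirror (rot a p) t′<K u′<K bt bu eqb
    -- Moving the origin by `p` shifts positions modulo `K`, while both pairs have sum `L`. No wrap
    -- gives p = 0, two wraps give p = K, and exactly one gives 2p = K.
    antipodal : t′ + p ≡ t ⊎ t′ + p ≡ t + K → u′ + p ≡ u ⊎ u′ + p ≡ u + K → p + p ≡ K
    antipodal (inj₁ x) (inj₁ y) = lin 7 (λ t u t′ u′ p k l → t :+ u := l :⇒ t′ :+ u′ := l :⇒ con 0 :< p :⇒ t′ :+ p := t :⇒ u′ :+ p := u :⇒ ⊢ p :+ p := k)
      t u t′ u′ p K L s s′ 0<p x y
    antipodal (inj₁ x) (inj₂ y) = lin 7 (λ t u t′ u′ p k l → t :+ u := l :⇒ t′ :+ u′ := l :⇒ t′ :+ p := t :⇒ u′ :+ p := u :+ k :⇒ ⊢ p :+ p := k)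
      t u t′ u′ p K L s s′ x y
    antipodal (inj₂ x) (inj₁ y) = lin 7 (λ t u t′ u′ p k l → t :+ u := l :⇒ t′ :+ u′ := l :⇒ t′ :+ p := t :+ k :⇒ u′ :+ p := u :⇒ ⊢ p :+ p := k)
      t u t′ u′ p K L s s′ x y
    antipodal (inj₂ x) (inj₂ y) = lin 7 (λ t u t′ u′ p k l → t :+ u := l :⇒ t′ :+ u′ := l :⇒ p :< k :⇒ t′ :+ p := t :+ k :⇒ u′ :+ p := u :+ k :⇒ ⊢ p :+ p := k)
      t u t′ u′ p K L s s′ p<K x y

  -- What is used of a geodesic triple A; cover says that each cycle edge lies on a geodesic between points of A.
  record Spread (A : Fin K → Set) : Set where
    field
      cover           : ∀ j → ∃[ a ] ∃[ b ] (A a × A b × cdist j a + suc (cdist (next j) b) ≤ cdist a b)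
      resolves        : ∀ {i j} → (∀ {a} → A a → cdist i a ≡ cdist j a) → i ≡ j
      resolves-edges  : ∀ {i j} → (∀ {a} → A a → edist i a ≡ edist j a) → i ≡ j

  -- An arc of at most half the cycle is a geodesic, and each of its edges cuts it into two pieces
  -- whose lengths bound the distances.
  arc-cover : ∀ a l t → l + l ≤ K → t < l → cdist (rot a t) a + suc (cdist (next (rot a t)) (rot a l)) ≤ cdist a (rot a l)
  arc-cover a l t 2l≤K t<l = lin 6 (λ x y z t l r → x :≤ t :⇒ r :+ (con 1 :+ t) := l :⇒ y :≤ r :⇒ z := l :⇒ ⊢ x :+ (con 1 :+ y) :≤ z)
    (cdist (rot a t) a) (cdist (next (rot a t)) (rot a l)) (cdist a (rot a l)) t l (l ∸ suc t)
    (subst (_≤ t) (dist-sym (c a) (c (rot a t))) (cdist-≤ a t)) (m∸n+n≡m t<l)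
    (subst (λ b → cdist (rot a (suc t)) b ≤ l ∸ suc t) (trans (rot-+ a (suc t) (l ∸ suc t)) (cong (rot a) (m∸n+n≡m t<l))) (cdist-≤ (rot a (suc t)) (l ∸ suc t)))
    (trans (dist-sym (c a) (c (rot a l))) (exact (cdist-around a l (≤-trans (m≤m+n l l) 2l≤K))))
    where
    exact : ∀ {d} → Around K l d → d ≡ l
    exact (inj₁ (eq , _))     = eq
    exact {d} (inj₂ (eq , h)) = lin 3 (λ d l k → d :+ l := k :⇒ k :≤ l :+ l :⇒ l :+ l :≤ k :⇒ ⊢ d := l) d l K eq h 2l≤K

  -- `p`, `q`, `r` are the arcs between consecutive points. Each is a geodesic, being at most half
  -- of `C`, and together they run through all cycle edges.
  triple-spread : ∀ {A} α p q r → p + q + r ≡ K → 0 < p → 0 < q → 0 < r → p + p ≤ K → q + q ≤ K → r + r ≤ K →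
                  A α → A (rot α p) → A (rot (rot α p) q) → Spread A
  triple-spread {A} α p q r total 0<p 0<q 0<r p≤ q≤ r≤ Aα Aβ Aγ = record
    { cover = cover
    ; resolves = λ eq → resolve cdist (λ a t t<K → cdist-around a t (<⇒≤ t<K)) eq
    ; resolves-edges = resolve edist edist-around
    }
    where
    β = rot α p
    γ = rot β q
    p<K : p < K
    p<K = lin 4 (λ p q r k → p :+ q :+ r := k :⇒ con 0 :< q :⇒ ⊢ p :< k) p q r K total 0<q
    q+p<K : q + p < K
    q+p<K = lin 4 (λ p q r k → p :+ q :+ r := k :⇒ con 0 :< r :⇒ ⊢ q :+ p :< k) p q r K total 0<r
    γ≡ : γ ≡ rot α (q + p)
    γ≡ = rot-+ α p q
    closed : rot γ r ≡ α
    closed = trans (cong (λ b → rot b r) γ≡) (trans (rot-+ α (q + p) r) (trans (cong (rot α)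
      (lin 4 (λ p q r k → p :+ q :+ r := k :⇒ ⊢ r :+ (q :+ p) := k) p q r K total)) (rot-full α)))
    resolve : ∀ {L} (f : Fin K → Fin K → ℕ) → (∀ a t → t < K → Around L t (f (rot a t) a)) →
              ∀ {i j} → (∀ {a} → A a → f i a ≡ f j a) → i ≡ j
    -- An unresolved pair would make both `p` and `q + p` equal to half of `K`, hence `q = 0`.
    resolve f around {i} {j} eq = decidable-stable (i Fin.≟ j) λ i≢j →
      lin 3 (λ p q k → p :+ p := k :⇒ q :+ p :+ (q :+ p) := k :⇒ con 0 :< q :⇒ ⊢ :⊥) p q K
        (mirrored f around α p 0<p p<K i≢j (eq Aα) (eq Aβ))
        (mirrored f around α (q + p) (≤-trans 0<p (m≤n+m p q)) q+p<K i≢j (eq Aα) (subst (λ b → f i b ≡ f j b) γ≡ (eq Aγ))) 0<q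
    cover : ∀ j → ∃[ a ] ∃[ b ] (A a × A b × cdist j a + suc (cdist (next j) b) ≤ cdist a b)
    cover j with rot-surjective α j
    ... | t , t<K , refl with <-≤-connex t p
    ...   | inj₁ t<p = α , β , Aα , Aβ , arc-cover α p t p≤ t<p
    ...   | inj₂ p≤t with <-≤-connex t (q + p)
    ...     | inj₁ t<q+p = β , γ , Aβ , Aγ ,
              subst (λ h → cdist h β + suc (cdist (next h) γ) ≤ cdist β γ)
                (trans (rot-+ α p (t ∸ p)) (cong (rot α) (m∸n+n≡m p≤t)))
                (arc-cover β q (t ∸ p) q≤ (lin 4 (λ d p t q → d :+ p := t :⇒ t :< q :+ p :⇒ ⊢ d :< q) (t ∸ p) p t q (m∸n+n≡m p≤t) t<q+p))
    ...     | inj₂ q+p≤t = γ , α , Aγ , Aα ,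
              subst₂ (λ h e → cdist h γ + suc (cdist (next h) e) ≤ cdist γ e)
                (trans (cong (λ b → rot b d) γ≡) (trans (rot-+ α (q + p) d) (cong (rot α) (m∸n+n≡m q+p≤t)))) closed
                (arc-cover γ r d r≤ (lin 6 (λ d p q r t k → d :+ (q :+ p) := t :⇒ t :< k :⇒ p :+ q :+ r := k :⇒ ⊢ d :< r) d p q r t K (m∸n+n≡m q+p≤t) t<K total))
      where d = t ∸ (q + p)

  halves : ∀ n → ∃[ q ] ∃[ r ] (q + r ≡ n × q ≤ r × r ≤ suc q)
  halves zero    = 0 , 0 , refl , z≤n , z≤n
  halves (suc n) with halves n
  ... | q , r , eq , le , le′ = r , suc q , trans (+-suc r q) (cong suc (trans (+-comm r q) eq)) , le′ , s≤s le

  -- `γ` is chosen before `A`, because the trees met by the final set are known only after `c γ` has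
  -- been put into it.
  ThirdPoint : Fin K → Fin K → Set₁
  ThirdPoint α β = ∃[ γ ] ∀ {A : Fin K → Set} → A α → A β → A γ → Spread A

  -- The third point is the middle of the longer arc. Its nearly equal halves stay within half of
  -- `C` because the shorter arc has length at least one.
  third-point : ∀ {α β} → α ≢ β → ThirdPoint α β
  third-point {α} {β} α≢β = let t , t<K , eq = rot-surjective α β in search t t<K eq (<-≤-connex K (t + t))
    where
    split : ∀ {α} t q r → 0 < t → t + t ≤ K → q + r ≡ K ∸ t → q ≤ r → r ≤ suc q → ThirdPoint α (rot α t)
    split {α} t q r 0<t 2t≤K eq q≤r r≤1+q = rot (rot α t) q , triple-spread α t q r total 0<t 0<q (≤-trans 0<q q≤r) 2t≤K
        (lin 4 (λ q r t k → t :+ q :+ r := k :⇒ q :≤ r :⇒ ⊢ q :+ q :≤ k) q r t K total q≤r)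
        (lin 4 (λ q r t k → t :+ q :+ r := k :⇒ con 0 :< t :⇒ r :≤ con 1 :+ q :⇒ ⊢ r :+ r :≤ k) q r t K total 0<t r≤1+q)
      where
      total : t + q + r ≡ K
      total = trans (+-assoc t q r) (trans (cong (t +_) eq) (m+[n∸m]≡n (≤-trans (m≤m+n t t) 2t≤K)))
      -- Here `K` being at least 3 matters: the longer arc must have two edges in order to be
      -- halved.
      0<q : 0 < q
      0<q = lin 4 (λ q r t k → t :+ q :+ r := k :⇒ r :≤ con 1 :+ q :⇒ t :+ t :≤ k :⇒ con 3 :≤ k :⇒ ⊢ con 0 :< q)
        q r t K total r≤1+q 2t≤K (m≤m+n 3 (Cycle.m C))
    near : ∀ {α β} t → α ≢ β → rot α t ≡ β → t + t ≤ K → ThirdPoint α β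
    near {α} t α≢β eq 2t≤K = let q , r , total , le , le′ = halves (K ∸ t) in
      subst (ThirdPoint α) eq (split t q r (n≢0⇒n>0 λ { refl → α≢β eq }) 2t≤K total le le′)
    search : ∀ t → t < K → rot α t ≡ β → K < t + t ⊎ t + t ≤ K → ThirdPoint α β
    search t t<K eq (inj₂ le) = near t α≢β eq le
    -- The arc from `α` to `β` exceeds half of `C`, so the roles are exchanged and the arc from `β`
    -- back to `α` is used.
    search t t<K eq (inj₁ gt) = let γ , spread = near (K ∸ t) (α≢β ∘ sym) back le in γ , λ {A} Aα Aβ → spread {A} Aβ Aα
      where
      t≤K = <⇒≤ t<K
      back : rot β (K ∸ t) ≡ α
      back = trans (cong (λ b → rot b (K ∸ t)) (sym eq)) (trans (rot-+ α t (K ∸ t)) (trans (cong (rot α) (m∸n+n≡m t≤K)) (rot-full α)))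
      le : K ∸ t + (K ∸ t) ≤ K
      le = lin 3 (λ d t k → d :+ t := k :⇒ k :< t :+ t :⇒ ⊢ d :+ d :≤ k) (K ∸ t) t K (m∸n+n≡m t≤K) gt

Unique-concatMap : ∀ {A B : Set} (f : A → List B) {xs} → Unique xs → (∀ x → Unique (f x)) →
                   (∀ {x y b} → b ∈ f x → b ∈ f y → x ≡ y) → Unique (concatMap f xs)
Unique-concatMap f u uf disjoint = concat⁺ (All.map⁺ (All.universal uf _))
  (AllPairs.map⁺ (AllPairs.map separate u))
  where
  separate : ∀ {x y} → x ≢ y → Disjoint (f x) (f y)
  separate x≢y (p , q) = x≢y (disjoint p q)

length-⊆ : ∀ {n} {xs : List (Fin n)} → Unique xs → length xs ≤ n
length-⊆ {n} {xs} u = subst (length xs ≤_) (length-tabulate {n = n} (λ i → i)) (Unique-⊆-length u (λ _ → ∈-allFin _))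

-- Threads and branch-active vertices

module Threads {n : ℕ} (G : Graph n) (conn : Connected G) (C : Cycle G) (uniq : OnlyCycle G C) where

  open Structure G conn C uniq

  deg-≤ : ∀ {u} ys → (∀ {x} → adj G u x ≡ true → x ∈ ys) → deg G u ≤ length ys
  deg-≤ {u} ys sub = countB-≤ (adj G u) ys (λ x e → sub e)

  deg-≥ : ∀ {u xs} → Unique xs → (∀ {x} → x ∈ xs → adj G u x ≡ true) → length xs ≤ deg G u
  deg-≥ {u} = countB-≥ (adj G u)

  new-neighbour : ∀ {u} ys → length ys < deg G u → ∃[ x ] (adj G u x ≡ true × x ∉ ys)
  new-neighbour {u} = countB-fresh (adj G u)

  deg-1 : ∀ {u a b} → deg G u ≡ 1 → adj G u a ≡ true → adj G u b ≡ true → a ≡ b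
  deg-1 {u} {a} {b} d ea eb = decidable-stable (a Fin.≟ b) λ a≢b →
    contradiction (subst (2 ≤_) d (deg-≥ ((a≢b ∷ []) ∷ [] ∷ []) (λ { (here refl) → ea ; (there (here refl)) → eb }))) λ { (s≤s ()) }

  deg-2 : ∀ {u a b x} → deg G u ≡ 2 → adj G u a ≡ true → adj G u b ≡ true → a ≢ b → adj G u x ≡ true → x ≡ a ⊎ x ≡ b
  deg-2 {u} {a} {b} {x} d ea eb a≢b ex with x Fin.≟ a | x Fin.≟ b
  ... | yes p | _     = inj₁ p
  ... | no _  | yes q = inj₂ q
  ... | no p  | no q  = contradiction (subst (3 ≤_) d (deg-≥ ((p ∷ q ∷ []) ∷ (a≢b ∷ []) ∷ [] ∷ [])
    (λ { (here refl) → ex ; (there (here refl)) → ea ; (there (there (here refl))) → eb }))) λ { (s≤s (s≤s ())) }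

  cycle-neighbours : ∀ i → ∃[ j ] (next j ≡ i × c (next i) ≢ c j)
  cycle-neighbours i = j , rot-full i , λ eq → absurd (rot-fixed (next i) l (m≤n⇒m≤1+n (n≤1+n l)) (trans (rot-+ i 1 l)
      (trans (cong (rot i) (+-comm l 1)) (sym (Cycle.inj C eq)))))
    where
    -- This is `K - 2`, the number of steps from `next i` on to the predecessor `j`; a rotation by
    -- it fixes nothing.
    l = suc (Cycle.m C)
    j = rot i (suc l)
    absurd : l ≡ 0 ⊎ l ≡ K → ⊥
    absurd (inj₂ eq) = m≢1+n+m l {1} eq

  -- A thread without the degree bound on its base, so that its tails are chains again; `p ≢ w`
  -- takes the place of the distinctness test.
  data Chain : V → List V → Set where
    last : ∀ {p u} → adj G u p ≡ true → deg G u ≡ 1 → Chain p (u ∷ [])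
    more : ∀ {p u w us} → adj G u p ≡ true → deg G u ≡ 2 → p ≢ w → Chain u (w ∷ us) → Chain p (u ∷ w ∷ us)

  head-adj : ∀ {p u us} → Chain p (u ∷ us) → adj G u p ≡ true
  head-adj (last e _)     = e
  head-adj (more e _ _ _) = e

  -- Induction from the leaf end. A cycle vertex has two neighbours on `C`, but `u` has at most one,
  -- since the next chain vertex is off `C`. Of the neighbours of `u`, that next vertex is a child,
  -- which leaves `p` as the parent.
  chain-Child : ∀ {p u us} → Chain p (u ∷ us) → Child u p
  chain-Child {p} {u} (last e d) = let z , ch = parent off in subst (Child u) (deg-1 d (Child-adj ch) e) ch
    where
    off : ¬ OnCycle u
    off (i , refl) with cycle-neighbours i
    ... | j , refl , ≢ = ≢ (deg-1 d (c-adj i) (adj-sym (c-adj j)))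
  chain-Child {p} {u} (more {w = w} e d p≢w ch) = let z , up = parent off in choose up (deg-2 d e e′ p≢w (Child-adj up))
    where
    e′ : adj G u w ≡ true
    e′ = adj-sym (head-adj ch)
    w-off : ¬ OnCycle w
    w-off = Child-off (chain-Child ch)
    off : ¬ OnCycle u
    off (i , refl) with cycle-neighbours i
    ... | j , refl , ≢ with deg-2 d e e′ p≢w (c-adj i) | deg-2 d e e′ p≢w (adj-sym (c-adj j))
    ...   | inj₂ eq | _       = w-off (_ , eq)
    ...   | inj₁ _  | inj₂ eq = w-off (_ , eq)
    ...   | inj₁ x  | inj₁ y  = ≢ (trans x (sym y))
    choose : ∀ {z} → Child u z → z ≡ p ⊎ z ≡ w → Child u p
    choose up (inj₁ refl) = up
    choose up (inj₂ refl) = contradiction up (Child-asym (chain-Child ch))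

  chain-above : ∀ {p us x} i → Chain p us → x ∈ us → dist (c i) p < dist (c i) x
  chain-above i ch@(last _ _)     (here refl) = ≤-reflexive (sym (lower (chain-Child ch) i))
  chain-above i ch@(more _ _ _ _) (here refl) = ≤-reflexive (sym (lower (chain-Child ch) i))
  chain-above i ch@(more _ _ _ t) (there x∈)  = <-trans (≤-reflexive (sym (lower (chain-Child ch) i))) (chain-above i t x∈)

  chain-closed : ∀ {p us x y} → Chain p us → y ∈ us → adj G y x ≡ true → x ∈ us ⊎ x ≡ p
  chain-closed (last e d) (here refl) e′ = inj₂ (deg-1 d e′ e)
  chain-closed (more e d p≢w ch) (here refl) e′ with deg-2 d e (adj-sym (head-adj ch)) p≢w e′
  ... | inj₁ x≡p = inj₂ x≡p
  ... | inj₂ x≡w = inj₁ (there (here x≡w))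
  chain-closed (more e d p≢w ch) (there y∈) e′ with chain-closed ch y∈ e′
  ... | inj₁ x∈  = inj₁ (there x∈)
  ... | inj₂ x≡u = inj₁ (here x≡u)

  chain-In : ∀ {p us x i} → Chain p us → In p i → x ∈ us → In x i
  chain-In ch@(last _ _)     q (here refl) = In-down (chain-Child ch) q
  chain-In ch@(more _ _ _ _) q (here refl) = In-down (chain-Child ch) q
  chain-In ch@(more _ _ _ t) q (there x∈)  = chain-In t (In-down (chain-Child ch) q) x∈

  chain-unique : ∀ {p us} → Chain p us → Unique us
  chain-unique (last _ _)      = [] ∷ []
  chain-unique (more _ _ _ ch) =
    All.tabulate (λ x∈ eq → <-irrefl (cong (dist (c zero)) eq) (chain-above zero ch x∈)) ∷ chain-unique ch

  chain-det : ∀ {p u us us′} → Chain p (u ∷ us) → Chain p (u ∷ us′) → us ≡ us′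
  chain-det (last _ _)     (last _ _)       = refl
  chain-det (last _ d)     (more _ d′ _ _)  = contradiction (trans (sym d) d′) λ ()
  chain-det (more _ d _ _) (last _ d′)      = contradiction (trans (sym d) d′) λ ()
  chain-det (more e d p≢w ch) (more _ _ p≢w′ ch′) with deg-2 d e (adj-sym (head-adj ch)) p≢w (adj-sym (head-adj ch′))
  ... | inj₁ w′≡p = contradiction (sym w′≡p) p≢w′
  ... | inj₂ refl = cong (_ ∷_) (chain-det ch ch′)

  -- Up x v u: the nearest proper ancestor of x of degree at least 3 is v, reached through its child u.
  data Up : V → V → V → Set where
    base : ∀ {x v} → Child x v → 3 ≤ deg G v → Up x v x
    step : ∀ {x y v u} → Child x y → deg G y ≤ 2 → Up y v u → Up x v u

  Up-det : ∀ {x v u v′ u′} → Up x v u → Up x v′ u′ → v ≡ v′ × u ≡ u′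
  Up-det (base p _)   (base p′ _)    = parent-unique p p′ , refl
  Up-det (base p d)   (step p′ d′ _) = contradiction d′ (<⇒≱ (subst (λ y → 3 ≤ deg G y) (parent-unique p p′) d))
  Up-det (step p d _) (base p′ d′)   = contradiction d (<⇒≱ (subst (λ y → 3 ≤ deg G y) (parent-unique p′ p) d′))
  Up-det (step p _ q) (step p′ _ q′) = Up-det q (subst (λ y → Up y _ _) (parent-unique p′ p) q′)

  Thread : V → List V → Set
  Thread v l = 3 ≤ deg G v × Chain v l

  thread-Up : ∀ {v u us x} → Thread v (u ∷ us) → x ∈ u ∷ us → Up x v u
  thread-Up (d , ch) (here refl) = base (chain-Child ch) d
  thread-Up (d , ch@(more _ d′ _ t)) (there x∈) = below t (≤-reflexive d′) (base (chain-Child ch) d) x∈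
    where
    below : ∀ {p us x v u} → Chain p us → deg G p ≤ 2 → Up p v u → x ∈ us → Up x v u
    below ch@(last _ _)      d up (here refl) = step (chain-Child ch) d up
    below ch@(more _ _ _ _)  d up (here refl) = step (chain-Child ch) d up
    below ch@(more _ d′ _ t) d up (there x∈)  = below t (≤-reflexive d′) (step (chain-Child ch) d up) x∈

  -- From a thread vertex the climb to the first vertex of degree at least 3 is forced, and the
  -- child through which it arrives fixes the thread. This disjointness lets one vertex of `S` be
  -- counted per thread.
  thread-det : ∀ {v l v′ l′ x} → Thread v l → Thread v′ l′ → x ∈ l → x ∈ l′ → v ≡ v′ × l ≡ l′
  thread-det {l = u ∷ us} {l′ = u′ ∷ us′} t t′ x∈ x∈′ with Up-det (thread-Up t x∈) (thread-Up t′ x∈′)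
  ... | refl , refl = refl , cong (u ∷_) (chain-det (proj₂ t) (proj₂ t′))
  thread-det {l = []} (_ , ()) t′ x∈ x∈′

  private
    -- distinct, consecAdj and degOK are private to Defs; the metavariables name them.
    isThread-unfold : Σ[ distinct ∈ (List V → Bool) ] Σ[ rest ∈ (V → List V → Bool) ]
      (∀ v u us → isThread G v (u ∷ us) ≡
        (3 ≤ᵇ deg G v) ∧ adj G u v ∧ (not (any (λ y → ⌊ u Fin.≟ y ⌋) us) ∧ distinct us) ∧ rest u us)
    isThread-unfold = _ , _ , λ v u us → refl

    distinct : List V → Bool
    distinct = proj₁ isThread-unfold

    rest : V → List V → Bool
    rest = proj₁ (proj₂ isThread-unfold)

    split : ∀ a {b} → a ∧ b ≡ true → a ≡ true × b ≡ true
    split true eq = refl , eq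

    -- `rest` joins an adjacency test and a degree test, each on the whole list. Regrouping takes
    -- off both heads and leaves the `rest` of the tail.
    split-rest : ∀ a b {x y} → (a ∧ x) ∧ (b ∧ y) ≡ true → a ≡ true × b ≡ true × x ∧ y ≡ true
    split-rest true true {true} {true} _ = refl , refl , refl

    join-rest : ∀ a b {x y} → a ≡ true → b ≡ true → x ∧ y ≡ true → (a ∧ x) ∧ (b ∧ y) ≡ true
    join-rest true true {true} {true} _ _ _ = refl

    fresh : ∀ {u : V} {us} → not (any (λ y → ⌊ u Fin.≟ y ⌋) us) ≡ true → u ∉ us
    fresh {u} eq u∈ with trans (sym (not-true eq)) (true-any (λ y → ⌊ u Fin.≟ y ⌋) u∈ (≟-refl u))
    ... | ()

    fresh-intro : ∀ {u : V} {us} → u ∉ us → not (any (λ y → ⌊ u Fin.≟ y ⌋) us) ≡ true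
    fresh-intro {u} {us} u∉ with any (λ y → ⌊ u Fin.≟ y ⌋) us in eq
    ... | false = refl
    ... | true  = let x , x∈ , t = any-true (λ y → ⌊ u Fin.≟ y ⌋) us eq in
      contradiction (subst (_∈ us) (sym (≟-true t)) x∈) u∉

    ≡ᵇ-true : ∀ {a b} → (a ≡ᵇ b) ≡ true → a ≡ b
    ≡ᵇ-true {a} {b} eq = ≡ᵇ⇒≡ a b (subst T (sym eq) _)

    true-≡ᵇ : ∀ {a b} → a ≡ b → (a ≡ᵇ b) ≡ true
    true-≡ᵇ {a} {b} eq = Equivalence.to T-≡ (≡⇒≡ᵇ a b eq)

    toChain : ∀ {p u us} → p ∉ us → adj G u p ≡ true → not (any (λ y → ⌊ u Fin.≟ y ⌋) us) ≡ true →
              distinct us ≡ true → rest u us ≡ true → Chain p (u ∷ us)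
    toChain {u = u} {[]}     p∉ e new d r = last e (≡ᵇ-true r)
    toChain {u = u} {w ∷ us} p∉ e new d r =
      let e′ , d2 , r′ = split-rest (adj G u w) (deg G u ≡ᵇ 2) r
          new′ , d′ = split (not (any (λ y → ⌊ w Fin.≟ y ⌋) us)) d
      in more e (≡ᵇ-true d2) (λ p≡w → p∉ (here p≡w)) (toChain {us = us} (λ u∈ → fresh new (there u∈)) (adj-sym e′) new′ d′ r′)

    fromUnique : ∀ {us} → Unique us → distinct us ≡ true
    fromUnique []        = refl
    fromUnique (u∉ ∷ us) = cong₂ _∧_ (fresh-intro (λ u∈ → All.lookup u∉ u∈ refl)) (fromUnique us)

    fromChain : ∀ {p u us} → Chain p (u ∷ us) → rest u us ≡ true
    fromChain (last e d)                     = true-≡ᵇ d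
    fromChain {u = u} (more {w = w} e d _ ch) =
      join-rest (adj G u w) (deg G u ≡ᵇ 2) (adj-sym (head-adj ch)) (true-≡ᵇ d) (fromChain ch)

  ≤ᵇ-true : ∀ {a b} → (a ≤ᵇ b) ≡ true → a ≤ b
  ≤ᵇ-true {a} {b} eq = ≤ᵇ⇒≤ a b (subst T (sym eq) _)

  true-≤ᵇ : ∀ {a b} → a ≤ b → (a ≤ᵇ b) ≡ true
  true-≤ᵇ le = Equivalence.to T-≡ (≤⇒≤ᵇ le)

  isThread⇒Thread : ∀ {v l} → isThread G v l ≡ true → Thread v l
  isThread⇒Thread {v} {u ∷ us} eq =
    let d3 , eq₁ = split (3 ≤ᵇ deg G v) eq
        e , eq₂ = split (adj G u v) eq₁
        dis , r = split (not (any (λ y → ⌊ u Fin.≟ y ⌋) us) ∧ distinct us) eq₂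
        new , d = split (not (any (λ y → ⌊ u Fin.≟ y ⌋) us)) dis
    -- The list cannot return to `v`: its vertices have degree at most 2.
    in ≤ᵇ-true d3 , toChain (λ v∈ → <⇒≱ (≤ᵇ-true d3) (small {us = us} d r v∈)) e new d r
    where
    small-head : ∀ {u us} → rest u us ≡ true → deg G u ≤ 2
    small-head {u} {[]}     r = ≤-trans (≤-reflexive (≡ᵇ-true r)) (n≤1+n 1)
    small-head {u} {w ∷ us} r = ≤-reflexive (≡ᵇ-true (proj₁ (proj₂ (split-rest (adj G u w) (deg G u ≡ᵇ 2) r))))
    small : ∀ {u us x} → distinct us ≡ true → rest u us ≡ true → x ∈ us → deg G x ≤ 2
    small {u} {w ∷ us} d r x∈ with split-rest (adj G u w) (deg G u ≡ᵇ 2) r | split (not (any (λ y → ⌊ w Fin.≟ y ⌋) us)) d | x∈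
    ... | _ , _ , r′ | _ , _  | here refl = small-head {us = us} r′
    ... | _ , _ , r′ | _ , d′ | there x∈′ = small {us = us} d′ r′ x∈′

  Thread⇒isThread : ∀ {v l} → Thread v l → isThread G v l ≡ true
  Thread⇒isThread {v} {u ∷ us} (d , ch) = cong₂ _∧_ (true-≤ᵇ d) (cong₂ _∧_ (head-adj ch)
    (cong₂ _∧_ (fromUnique (chain-unique ch)) (fromChain ch)))

  private
    ∈-listsOfLength : ∀ l → l ∈ listsOfLength G (length l)
    ∈-listsOfLength []      = here refl
    ∈-listsOfLength (x ∷ l) = ∈-concatMap⁺ (λ l → map (_∷ l) (allFin n)) (lose (∈-listsOfLength l) (∈-map⁺ (_∷ l) (∈-allFin x)))

    listsOfLength-length : ∀ j {l} → l ∈ listsOfLength G j → length l ≡ j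
    listsOfLength-length zero    (here refl) = refl
    listsOfLength-length (suc j) l∈ with find (∈-concatMap⁻ (λ l → map (_∷ l) (allFin n)) {xs = listsOfLength G j} l∈)
    ... | l′ , l′∈ , l∈′ with ∈-map⁻ (_∷ l′) l∈′
    ...   | x , _ , refl = cong suc (listsOfLength-length j l′∈)

    Unique-listsOfLength : ∀ j → Unique (listsOfLength G j)
    Unique-listsOfLength zero    = [] ∷ []
    Unique-listsOfLength (suc j) = Unique-concatMap (λ l → map (_∷ l) (allFin n)) (Unique-listsOfLength j)
      (λ l → map⁺ (λ { refl → refl }) (allFin⁺ n)) same
      where
      same : ∀ {l l′ k} → k ∈ map (_∷ l) (allFin n) → k ∈ map (_∷ l′) (allFin n) → l ≡ l′
      same {l} {l′} p q with ∈-map⁻ (_∷ l) p | ∈-map⁻ (_∷ l′) q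
      ... | _ , _ , refl | _ , _ , refl = refl

    -- Blocks of different index hold lists of different lengths. Hence `ℓ` counts every thread
    -- once.
    Unique-candidatePaths : Unique (candidatePaths G)
    Unique-candidatePaths = Unique-concatMap (λ j → listsOfLength G (suc j)) (upTo⁺ n) (λ j → Unique-listsOfLength (suc j))
      (λ p q → suc-injective (trans (sym (listsOfLength-length _ p)) (listsOfLength-length _ q)))

  threadsAt : V → List (List V)
  threadsAt v = select (isThread G v) (candidatePaths G)

  length-threadsAt : ∀ v → length (threadsAt v) ≡ ℓ G v
  length-threadsAt v = length-select (isThread G v) (candidatePaths G)

  Unique-threadsAt : ∀ v → Unique (threadsAt v)
  Unique-threadsAt v = Unique-select (isThread G v) Unique-candidatePaths

  threadsAt-sound : ∀ {v l} → l ∈ threadsAt v → Thread v l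
  threadsAt-sound {v} l∈ = isThread⇒Thread (proj₂ (∈-select⁻ (isThread G v) (candidatePaths G) l∈))

  threadsAt-complete : ∀ {v l} → Thread v l → l ∈ threadsAt v
  threadsAt-complete {v} {u ∷ us} t = ∈-select⁺ (isThread G v)
    (∈-concatMap⁺ (λ j → listsOfLength G (suc j)) (lose (∈-upTo⁺ (length-⊆ (chain-unique (proj₂ t)))) (∈-listsOfLength (u ∷ us))))
    (Thread⇒isThread t)

  private
    onC-intro : ∀ {x} → OnCycle x → onC G C x ≡ true
    onC-intro {x} (i , refl) = true-any (λ j → ⌊ c j Fin.≟ x ⌋) (∈-allFin i) (≟-refl (c i))

    onC-elim : ∀ {x} → onC G C x ≡ true → OnCycle x
    onC-elim {x} eq = let i , _ , t = any-true (λ j → ⌊ c j Fin.≟ x ⌋) (allFin K) eq in i , ≟-true t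

  branching-intro : ∀ {x} → (¬ OnCycle x → 3 ≤ deg G x) → (OnCycle x → 4 ≤ deg G x) → branching G C x ≡ true
  branching-intro {x} off on with onC G C x in eq
  ... | true  = true-≤ᵇ (on (onC-elim eq))
  ... | false rewrite true-≤ᵇ (off (λ o → contradiction (trans (sym eq) (onC-intro o)) λ ())) = refl

  branching-elim : ∀ {x} → branching G C x ≡ true → (¬ OnCycle x × 3 ≤ deg G x) ⊎ (OnCycle x × 4 ≤ deg G x)
  branching-elim {x} eq with onC G C x in on
  ... | true  = inj₂ (onC-elim on , ≤ᵇ-true eq)
  ... | false = inj₁ ((λ o → contradiction (trans (sym on) (onC-intro o)) λ ()) ,
                      ≤ᵇ-true (trans (sym (∨-identityʳ (3 ≤ᵇ deg G x))) eq))

  private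
    adjT-intro : ∀ {x y} → Bridge x y → adjT G C x y ≡ true
    adjT-intro (e , b) = cong₂ _∧_ e (cong not b)

    reach-sound : ∀ j {i x} → reachT G C j (c i) x ≡ true → In x i
    reach-sound zero    {i} eq = subst (λ x → In x i) (≟-true eq) (In-c i)
    reach-sound (suc j) {i} {x} eq with reachT G C j (c i) x in eq′
    ... | true  = reach-sound j eq′
    ... | false with any-true (λ w → reachT G C j (c i) w ∧ adjT G C w x) (allFin n) eq
    ...   | w , _ , eqw with ∧-true eqw
    ...     | r , a = In-bridge (let e , b = ∧-true a in e , not-true b) (reach-sound j r)

    -- A parent is reached one round before its child, so height `j` needs `j` rounds; heights stay
    -- below `n`, the number of rounds in `inT`.
    reach-complete : ∀ j {i x} → In x i → dist (c i) x ≤ j → reachT G C j (c i) x ≡ true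
    reach-complete zero {i} p le with dist-zero (n≤0⇒n≡0 le)
    ... | refl = ≟-refl (c i)
    reach-complete (suc j) {i} {x} p le with m≤n⇒m<n∨m≡n le
    ... | inj₁ lt = cong (_∨ any (λ w → reachT G C j (c i) w ∧ adjT G C w x) (allFin n)) (reach-complete j p (s≤s⁻¹ lt))
    ... | inj₂ eq with parent (In-off p λ { refl → contradiction (trans (sym (dist-refl (c i))) eq) λ () })
    ...   | z , ch = trans (cong (reachT G C j (c i) x ∨_) (true-any (λ w → reachT G C j (c i) w ∧ adjT G C w x) (∈-allFin z)
              (cong₂ _∧_ (reach-complete j (In-up ch p) (≤-reflexive (suc-injective (trans (sym (lower ch i)) eq))))
                (adjT-intro (bridge-sym (bridge ch)))))) (∨-zeroʳ _)

  branchActive-intro : ∀ {x i} → In x i → branching G C x ≡ true → branchActive G C i ≡ true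
  branchActive-intro {x} {i} p b = true-any (λ w → inT G C (c i) w ∧ branching G C w) (∈-allFin x)
    (cong₂ _∧_ (reach-complete n p (<⇒≤ (dist<n (c i) x))) b)

  branchActive-elim : ∀ {i} → branchActive G C i ≡ true → ∃[ x ] (In x i × branching G C x ≡ true)
  branchActive-elim {i} eq with any-true (λ w → inT G C (c i) w ∧ branching G C w) (allFin n) eq
  ... | x , _ , eqx with ∧-true eqx
  ...   | r , b = x , reach-sound n r , b

excess : ℕ → ℕ
excess a = if 1 <ᵇ a then a ∸ 1 else 0

excess≡pred : ∀ a → excess a ≡ a ∸ 1
excess≡pred 0             = refl
excess≡pred 1             = refl
excess≡pred (suc (suc _)) = refl

length-concatMap-≥ : ∀ {A B : Set} (f : A → List B) (g : A → ℕ) → (∀ x → g x ≤ length (f x)) →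
                     ∀ xs → sum (map g xs) ≤ length (concatMap f xs)
length-concatMap-≥ f g le []       = z≤n
length-concatMap-≥ f g le (x ∷ xs) =
  subst (g x + sum (map g xs) ≤_) (sym (length-++ (f x))) (+-mono-≤ (le x) (length-concatMap-≥ f g le xs))

-- The lower bound

module LowerBound {n : ℕ} (G : Graph n) (conn : Connected G) (C : Cycle G) (uniq : OnlyCycle G C) where

  open Structure G conn C uniq
  open Threads G conn C uniq

  Resolves : Subset n → Set
  Resolves S = ∀ u v → u ≢ v → ∃[ s ] (s Subset.∈ S × dist u s ≢ dist v s)

  ResolvesEdges : Subset n → Set
  ResolvesEdges S = ∀ u v u′ v′ → adj G u v ≡ true → adj G u′ v′ ≡ true → ¬ SameEdge G u v u′ v′ →
    ∃[ s ] (s Subset.∈ S × dist u s ⊓ dist v s ≢ dist u′ s ⊓ dist v′ s)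

  -- Equivalently, at each vertex at most one thread avoids `S`.
  BranchResolving : Subset n → Set
  BranchResolving S = ∀ {v l l′} → Thread v l → Thread v l′ → l ≢ l′ → ∃[ s ] (s Subset.∈ S × (s ∈ l ⊎ s ∈ l′))

  Biactive : Subset n → Set
  Biactive S = ∀ i → ∃[ s ] (s Subset.∈ S × ¬ In s i)

  thread-gate : ∀ {v u us s} → Thread v (u ∷ us) → s ∉ u ∷ us → dist u s ≡ suc (dist v s)
  thread-gate {v} {u} {us} {s} (_ , ch) s∉ = begin
    dist u s              ≡⟨ dist-sym u s ⟩
    dist s u              ≡⟨ gate (_∉ u ∷ us) (λ x → ¬? (mem? x)) v exit s∉ (λ u∉ → u∉ (here refl)) ⟩
    dist s v + dist v u   ≡⟨ cong₂ _+_ (dist-sym s v) (dist-adj≡1 (adj-sym (head-adj ch))) ⟩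
    dist v s + 1          ≡⟨ +-comm (dist v s) 1 ⟩
    suc (dist v s)        ∎
    where
    open ≡-Reasoning
    mem? : ∀ x → Dec (x ∈ u ∷ us)
    mem? x = DecMembership._∈?_ Fin._≟_ x (u ∷ us)
    exit : ∀ {x y} → adj G x y ≡ true → x ∉ u ∷ us → ¬ (y ∉ u ∷ us) → x ≡ v
    exit {x} {y} e x∉ y∈ with chain-closed ch (decidable-stable (mem? y) y∈) (adj-sym e)
    ... | inj₁ x∈  = contradiction x∈ x∉
    ... | inj₂ x≡v = x≡v

  heads-differ : ∀ {v u us u′ us′} → Thread v (u ∷ us) → Thread v (u′ ∷ us′) → u ∷ us ≢ u′ ∷ us′ → u ≢ u′
  heads-differ {u = u} (_ , ch) (_ , ch′) ne refl = ne (cong (u ∷_) (chain-det ch ch′))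

  private
    hit-or-gates : ∀ {v u us u′ us′ s} → Thread v (u ∷ us) → Thread v (u′ ∷ us′) →
      (s ∈ u ∷ us ⊎ s ∈ u′ ∷ us′) ⊎ (dist u s ≡ suc (dist v s) × dist u′ s ≡ suc (dist v s))
    hit-or-gates {u = u} {us} {u′} {us′} {s} t t′
      with DecMembership._∈?_ Fin._≟_ s (u ∷ us) | DecMembership._∈?_ Fin._≟_ s (u′ ∷ us′)
    ... | yes p | _      = inj₁ (inj₁ p)
    ... | no _  | yes p  = inj₁ (inj₂ p)
    ... | no ¬p | no ¬p′ = inj₂ (thread-gate t ¬p , thread-gate t′ ¬p′)

  Resolves⇒BranchResolving : ∀ {S} → Resolves S → BranchResolving S
  Resolves⇒BranchResolving r {v} {u ∷ us} {u′ ∷ us′} t t′ ne with r u u′ (heads-differ t t′ ne)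
  ... | s , s∈ , d≢ with hit-or-gates {s = s} t t′
  ...   | inj₁ hit      = s , s∈ , hit
  ...   | inj₂ (p , p′) = contradiction (trans p (sym p′)) d≢

  ResolvesEdges⇒BranchResolving : ∀ {S} → ResolvesEdges S → BranchResolving S
  ResolvesEdges⇒BranchResolving r {v} {u ∷ us} {u′ ∷ us′} t t′ ne
    with r u v u′ v (head-adj (proj₂ t)) (head-adj (proj₂ t′)) distinct
    where
    distinct : ¬ SameEdge G u v u′ v
    distinct (inj₁ (u≡u′ , _))   = heads-differ t t′ ne u≡u′
    distinct (inj₂ (u≡v , v≡u′)) = heads-differ t t′ ne (trans u≡v v≡u′)
  ... | s , s∈ , d≢ with hit-or-gates {s = s} t t′
  ...   | inj₁ hit      = s , s∈ , hit
  ...   | inj₂ (p , p′) = contradiction (cong (_⊓ dist v s) (trans p (sym p′))) d≢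

  -- Both cycle neighbours of `c i` are seen from inside its tree through `c i`, one step beyond it.
  Resolves⇒Biactive : ∀ {S} → Resolves S → Biactive S
  Resolves⇒Biactive r i with cycle-neighbours i
  ... | j , next-j , ne with r (c (next i)) (c j) ne
  ...   | s , s∈ , d≢ = s , s∈ , λ p → d≢ (trans (p (next i)) (trans (cong (_+ dist (c i) s)
            (trans (dist-adj≡1 (adj-sym (c-adj i))) (sym (dist-adj≡1 (subst (λ h → adj G (c j) (c h) ≡ true) next-j (c-adj j))))))
            (sym (p j))))

  -- From inside the tree, the nearer end of both cycle edges at `c i` is `c i` itself, so the two
  -- minima coincide.
  ResolvesEdges⇒Biactive : ∀ {S} → ResolvesEdges S → Biactive S
  ResolvesEdges⇒Biactive r i with cycle-neighbours i
  ... | j , next-j , ne with r (c (next i)) (c i) (c j) (c i) (adj-sym (c-adj i)) e distinct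
    where
    e : adj G (c j) (c i) ≡ true
    e = subst (λ h → adj G (c j) (c h) ≡ true) next-j (c-adj j)
    distinct : ¬ SameEdge G (c (next i)) (c i) (c j) (c i)
    distinct (inj₁ (p , _)) = ne p
    distinct (inj₂ (p , q)) = ne (trans p q)
  ...   | s , s∈ , d≢ = s , s∈ , λ p → d≢ (trans (m≥n⇒m⊓n≡n (below p (next i))) (sym (m≥n⇒m⊓n≡n (below p j))))
    where
    below : ∀ {s} → In s i → ∀ j → dist (c i) s ≤ dist (c j) s
    below {s} p j = subst (dist (c i) s ≤_) (sym (p j)) (m≤n+m _ _)

  -- On the cycle, two thread heads and two cycle neighbours make degree 4; off the cycle, the
  -- degree 3 required of the base of a thread is enough.
  two-threads-active : ∀ {v l l′ i} → Thread v l → Thread v l′ → l ≢ l′ → In v i → branchActive G C i ≡ true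
  two-threads-active {v} {u ∷ us} {u′ ∷ us′} (d , ch) (d′ , ch′) ne p = branchActive-intro p (branching-intro (λ _ → d) on)
    where
    on : OnCycle v → 4 ≤ deg G v
    on (i , refl) with cycle-neighbours i
    ... | j , refl , ≢′ = deg-≥
        ((heads-differ (d , ch) (d′ , ch′) ne ∷ off ch (next i) ∷ off ch j ∷ []) ∷ (off ch′ (next i) ∷ off ch′ j ∷ []) ∷ (≢′ ∷ []) ∷ [] ∷ [])
        (λ { (here refl)                         → adj-sym (head-adj ch)
           ; (there (here refl))                 → adj-sym (head-adj ch′)
           ; (there (there (here refl)))         → c-adj i
           ; (there (there (there (here refl)))) → adj-sym (c-adj j) })
      where
      off : ∀ {u us} → Chain (c (next j)) (u ∷ us) → ∀ h → u ≢ c h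
      off ch h eq = Child-off (chain-Child ch) (h , sym eq)

  module _ (S : Subset n) (br : BranchResolving S) where

    Hits : List (List V) → ℕ → Set
    Hits ls k = ∃[ X ] (Unique X × (∀ {x} → x ∈ X → x Subset.∈ S × ∃[ l ] (l ∈ ls × x ∈ l)) × k ≤ length X)

    private
      hits-∷ : ∀ {v l ls k s} → (∀ {l} → l ∈ ls → Thread v l) → Thread v l → l ∉ ls → s Subset.∈ S → s ∈ l →
               Hits ls k → Hits (l ∷ ls) (suc k)
      hits-∷ {v} {l} {ls} {s = s} ts t l∉ s∈S s∈l (X , u , ok , len) = s ∷ X , All.tabulate new ∷ u , ok′ , s≤s len
        where
        new : ∀ {x} → x ∈ X → s ≢ x
        new x∈ refl with ok x∈
        ... | _ , l′ , l′∈ , s∈l′ = l∉ (subst (_∈ ls) (sym (proj₂ (thread-det t (ts l′∈) s∈l s∈l′))) l′∈)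
        ok′ : ∀ {x} → x ∈ s ∷ X → x Subset.∈ S × ∃[ l′ ] (l′ ∈ l ∷ ls × x ∈ l′)
        ok′ (here refl) = s∈S , l , here refl , s∈l
        ok′ (there x∈)  = let x∈S , l′ , l′∈ , x∈l′ = ok x∈ in x∈S , l′ , there l′∈ , x∈l′

      hits-all : ∀ {v} ls → Unique ls → (∀ {l} → l ∈ ls → Thread v l) →
                 (∀ {l} → l ∈ ls → ∃[ s ] (s Subset.∈ S × s ∈ l)) → Hits ls (length ls)
      hits-all []       _        ts hit = [] , [] , (λ ()) , z≤n
      hits-all (l ∷ ls) (l∉ ∷ u) ts hit = let s , s∈S , s∈l = hit (here refl) in
        hits-∷ (λ l∈ → ts (there l∈)) (ts (here refl)) (λ l∈ → All.lookup l∉ l∈ refl) s∈S s∈l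
          (hits-all ls u (λ l∈ → ts (there l∈)) (λ l∈ → hit (there l∈)))

      grow : ∀ {l ls k} → Hits ls k → Hits (l ∷ ls) k
      grow (X , u , ok , len) = X , u , (λ x∈ → let x∈S , l , l∈ , x∈l = ok x∈ in x∈S , l , there l∈ , x∈l) , len

      weaken : ∀ {ls j k} → j ≤ k → Hits ls k → Hits ls j
      weaken le (X , u , ok , len) = X , u , ok , ≤-trans le len

    -- If the first thread avoids `S`, then `br` forces all others to meet it; if it meets `S`, at
    -- most one of the rest is lost by recursion.
    hits : ∀ {v} ls → Unique ls → (∀ {l} → l ∈ ls → Thread v l) → Hits ls (length ls ∸ 1)
    hits []       _        ts = [] , [] , (λ ()) , z≤n
    hits {v} (l ∷ ls) (l∉ ∷ u) ts with Any.any? (_∈ˢ? S) l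
    ... | yes some = let s , s∈l , s∈S = find some in
      weaken (pred≤ (length ls)) (hits-∷ (λ l∈ → ts (there l∈)) (ts (here refl)) (λ l∈ → All.lookup l∉ l∈ refl) s∈S s∈l
        (hits ls u (λ l∈ → ts (there l∈))))
      where
      pred≤ : ∀ a → a ≤ suc (a ∸ 1)
      pred≤ zero    = z≤n
      pred≤ (suc a) = ≤-refl
    ... | no none = grow (hits-all ls u (λ l∈ → ts (there l∈)) hit)
      where
      hit : ∀ {l′} → l′ ∈ ls → ∃[ s ] (s Subset.∈ S × s ∈ l′)
      hit l′∈ with br (ts (here refl)) (ts (there l′∈)) (All.lookup l∉ l′∈)
      ... | s , s∈S , inj₁ s∈l  = contradiction (lose s∈l s∈S) none
      ... | s , s∈S , inj₂ s∈l′ = s , s∈S , s∈l′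

    Chosen : V → Set
    Chosen v = ∃[ X ] (Unique X × (∀ {x} → x ∈ X → x Subset.∈ S × (1 < ℓ G v) × ∃[ l ] (Thread v l × x ∈ l)) × excess (ℓ G v) ≤ length X)

    chosen : ∀ v → Chosen v
    chosen v with <-≤-connex 1 (ℓ G v)
    ... | inj₂ small = [] , [] , (λ ()) , ≤-trans (≤-reflexive (excess≡pred (ℓ G v))) (∸-monoˡ-≤ 1 small)
    ... | inj₁ large with hits (threadsAt v) (Unique-threadsAt v) threadsAt-sound
    ...   | X , u , ok , len = X , u , (λ x∈ → let x∈S , l , l∈ , x∈l = ok x∈ in x∈S , large , l , threadsAt-sound l∈ , x∈l) ,
            subst (_≤ length X) (trans (cong (_∸ 1) (length-threadsAt v)) (sym (excess≡pred (ℓ G v)))) len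

    thread-vertices : List V
    thread-vertices = concatMap (λ v → proj₁ (chosen v)) (allFin n)

    thread-vertices-unique : Unique thread-vertices
    thread-vertices-unique = Unique-concatMap (λ v → proj₁ (chosen v)) (allFin⁺ n) (λ v → proj₁ (proj₂ (chosen v))) same
      where
      same : ∀ {v v′ x} → x ∈ proj₁ (chosen v) → x ∈ proj₁ (chosen v′) → v ≡ v′
      same {v} {v′} p q with proj₁ (proj₂ (proj₂ (chosen v))) p | proj₁ (proj₂ (proj₂ (chosen v′))) q
      ... | _ , _ , _ , t , x∈ | _ , _ , _ , t′ , x∈′ = proj₁ (thread-det t t′ x∈ x∈′)

    thread-vertices-length : LG G ≤ length thread-vertices
    thread-vertices-length = length-concatMap-≥ (λ v → proj₁ (chosen v)) (λ v → excess (ℓ G v))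
      (λ v → proj₂ (proj₂ (proj₂ (chosen v)))) (allFin n)

    -- The branch-active tree is recorded so that a vertex of `S` outside such trees can be
    -- recognised as new.
    thread-vertices-sound : ∀ {x} → x ∈ thread-vertices → x Subset.∈ S × ∃[ i ] (In x i × branchActive G C i ≡ true)
    thread-vertices-sound x∈ with find (∈-concatMap⁻ (λ v → proj₁ (chosen v)) {xs = allFin n} x∈)
    ... | v , _ , x∈X with proj₁ (proj₂ (proj₂ (chosen v))) x∈X
    ...   | x∈S , large , l , t , x∈l = x∈S , i , chain-In (proj₂ t) p x∈l , active
      where
      i = proj₁ (root v)
      p = proj₂ (root v)
      active : branchActive G C i ≡ true
      active with threadsAt v in eq | length-threadsAt v | Unique-threadsAt v
      ... | []          | len | _ = contradiction (subst (1 <_) (sym len) large) λ ()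
      ... | _ ∷ []      | len | _ = contradiction (subst (1 <_) (sym len) large) λ { (s≤s ()) }
      ... | a ∷ b ∷ _   | _   | (a≢b ∷ _) ∷ _ = two-threads-active (sound (here refl)) (sound (there (here refl))) a≢b p
        where
        sound : ∀ {l} → l ∈ a ∷ b ∷ _ → Thread v l
        sound l∈ = threadsAt-sound (subst (_ ∈_) (sym eq) l∈)

    lower-bound : Biactive S → LG G + (2 ∸ bG G C) ≤ ∣ S ∣
    lower-bound bi = bound (bG G C) refl
      where
      sound-S : ∀ {x} → x ∈ thread-vertices → x Subset.∈ S
      sound-S x∈ = proj₁ (thread-vertices-sound x∈)

      at-most : ∀ {b is} → bG G C ≡ b → Unique is → (∀ {i} → i ∈ is → branchActive G C i ≡ true) → length is ≤ b
      at-most eq u active = subst (_ ≤_) eq (countB-≥ (branchActive G C) u active)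

      bound : ∀ b → bG G C ≡ b → LG G + (2 ∸ b) ≤ ∣ S ∣
      bound (suc (suc b)) eq = subst (_≤ ∣ S ∣) (sym (trans (cong (LG G +_) (0∸n≡0 b)) (+-identityʳ (LG G))))
        (≤-trans thread-vertices-length (Unique-∣∣ S thread-vertices-unique sound-S))
      -- All counted vertices lie in the only branch-active tree, and `bi` supplies a vertex of `S`
      -- outside it.
      bound (suc zero) eq with countB-fresh (branchActive G C) [] (subst (0 <_) (sym eq) z<s)
      ... | i , active , _ with bi i
      ...   | s , s∈S , s∉ = subst (_≤ ∣ S ∣) (+-comm 1 (LG G)) (≤-trans (s≤s thread-vertices-length)
                (Unique-∣∣ S (All.tabulate new ∷ thread-vertices-unique) λ { (here refl) → s∈S ; (there x∈) → sound-S x∈ }))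
        where
        only-active : ∀ j → branchActive G C j ≡ true → i ≡ j
        only-active j active′ = decidable-stable (i Fin.≟ j) λ i≢j →
          1+n≰n (at-most eq ((i≢j ∷ []) ∷ [] ∷ []) λ { (here refl) → active ; (there (here refl)) → active′ })
        new : ∀ {x} → x ∈ thread-vertices → s ≢ x
        new x∈ refl = let _ , j , p , active′ = thread-vertices-sound x∈ in
          s∉ (subst (In s) (sym (only-active j active′)) p)
      -- Nothing was counted, so `LG G` is 0. Two vertices of `S` are still needed: any first one,
      -- and one outside its tree.
      bound zero eq with bi zero
      ... | s , s∈S , _ with bi (proj₁ (root s))
      ...   | s′ , s′∈S , s′∉ = ≤-trans (+-monoˡ-≤ 2 (≤-trans thread-vertices-length (≤-reflexive (empty thread-vertices thread-vertices-sound))))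
                (Unique-∣∣ S (((λ { refl → s′∉ (proj₂ (root s)) }) ∷ []) ∷ [] ∷ []) λ { (here refl) → s∈S ; (there (here refl)) → s′∈S })
        where
        empty : ∀ xs → (∀ {x} → x ∈ xs → x Subset.∈ S × ∃[ i ] (In x i × branchActive G C i ≡ true)) → length xs ≡ 0
        empty []       _     = refl
        empty (x ∷ xs) sound = let _ , i , _ , active = sound (here refl) in
          contradiction (at-most eq ([] ∷ []) λ { (here refl) → active }) λ ()

-- Sufficient conditions for resolving vertices and edges

module UpperBound {n : ℕ} (G : Graph n) (conn : Connected G) (C : Cycle G) (uniq : OnlyCycle G C) where

  open Structure G conn C uniq
  open CycleMetric G conn C uniq
  open Threads G conn C uniq
  open LowerBound G conn C uniq

  Near-trans : ∀ {w x z s} → Child w x → Child x z → Near w x s → Near x z s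
  Near-trans {w} {x} {z} {s} p q near = lin 4 (λ a b d e → a := con 1 :+ b :⇒ d := b :+ (con 1 :+ e) :⇒ e := con 1 :⇒ ⊢ a :< d)
    (dist s x) (dist s w) (dist s z) (dist x z) (near-dist (bridge p) near) (Near-gate (bridge p) near far) (dist-adj≡1 (Child-adj q))
    where
    far : ¬ Near w x z
    far near = lin 4 (λ hz hx hw d → hw := con 1 :+ hx :⇒ hx := con 1 :+ hz :⇒ hz := d :+ hw :⇒ ⊢ :⊥)
      (dist (c zero) z) (dist (c zero) x) (dist (c zero) w) (dist z w) (lower p zero) (lower q zero) (height-below zero p near)

  In-below : ∀ {w x s i} → Child w x → In x i → Near w x s → In s i
  In-below {w} {x} {s} {i} ch p near j = lin 6 (λ a b d e f g → a := b :+ d :⇒ d := e :+ f :⇒ g := b :+ f :⇒ ⊢ a := e :+ g)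
    (dist (c j) s) (dist s w) (dist (c j) w) (cdist j i) (dist (c i) w) (dist (c i) s)
    (height-below j ch near) (In-down ch p j) (height-below i ch near)

  parent-deg : ∀ {z x y} → x ≢ y → Child x z → Child y z → 3 ≤ deg G z
  parent-deg {z} {x} {y} x≢y p q with OnCycle? z
  ... | yes (i , refl) = deg-≥ ((x≢y ∷ off p ∷ []) ∷ (off q ∷ []) ∷ [] ∷ [])
        (λ { (here refl) → adj-sym (Child-adj p) ; (there (here refl)) → adj-sym (Child-adj q) ; (there (there (here refl))) → c-adj i })
    where
    off : ∀ {x} → Child x (c i) → x ≢ c (next i)
    off ch eq = Child-off ch (next i , sym eq)
  ... | no z-off with parent z-off
  ...   | w , r = deg-≥ ((x≢y ∷ up p ∷ []) ∷ (up q ∷ []) ∷ [] ∷ [])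
        (λ { (here refl) → adj-sym (Child-adj p) ; (there (here refl)) → adj-sym (Child-adj q) ; (there (there (here refl))) → Child-adj r })
    where
    up : ∀ {x} → Child x z → x ≢ w
    up ch refl = Child-asym ch r

  module _ (S : Subset n) (br : BranchResolving S) where

    Active : Fin K → Set
    Active i = ∃[ s ] (s Subset.∈ S × In s i)

    Hit : V → V → Set
    Hit x z = ∃[ s ] (s Subset.∈ S × Near x z s)

    PureThread : V → V → Set
    PureThread x z = ∃[ us ] (Chain z (x ∷ us) × (∀ {y} → y ∈ x ∷ us → Near x z y))

    private
      siblings : ∀ {x y z} → x ≢ y → Child x z → Child y z → Hit x z ⊎ PureThread x z → Hit y z ⊎ PureThread y z → Hit x z ⊎ Hit y z
      siblings x≢y p q (inj₁ h) _        = inj₁ h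
      siblings x≢y p q (inj₂ _) (inj₁ h) = inj₂ h
      siblings x≢y p q (inj₂ (us , ch , near)) (inj₂ (us′ , ch′ , near′))
        with br (parent-deg x≢y p q , ch) (parent-deg x≢y p q , ch′) (λ { refl → x≢y refl })
      ... | s , s∈S , inj₁ s∈ = inj₁ (s , s∈S , near s∈)
      ... | s , s∈S , inj₂ s∈ = inj₂ (s , s∈S , near′ s∈)

      hit-up : ∀ {w x z} → Child w x → Child x z → Hit w x → Hit x z
      hit-up p q (s , s∈S , near) = s , s∈S , Near-trans p q near

      near-self : ∀ {x z} → Child x z → Near x z x
      near-self ch = Near-self (adj-≢ (Child-adj ch))

      -- Two children yield a hit by `siblings`, a single child passes its verdict upwards, and a
      -- leaf starts a thread. Each call is one level deeper and heights stay below `n`, so the fuel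
      -- never runs out.
      explore : ∀ fuel {x z} → Child x z → n ≤ fuel + dist (c zero) x → Hit x z ⊎ PureThread x z
      explore zero {x} ch le = contradiction le (<⇒≱ (dist<n (c zero) x))
      explore (suc fuel) {x} {z} ch le with Fin.any? (λ w → (adj G x w Bool.≟ true) ×-dec ¬? (w Fin.≟ z))
      ... | no none = inj₂ ([] , last (Child-adj ch) (≤-antisym (deg-≤ (z ∷ []) only-z) (deg-≥ ([] ∷ []) λ { (here refl) → Child-adj ch })) ,
                            λ { (here refl) → near-self ch })
        where
        only-z : ∀ {w} → adj G x w ≡ true → w ∈ z ∷ []
        only-z {w} e = here (decidable-stable (w Fin.≟ z) λ w≢z → none (w , e , w≢z))
      ... | yes (w , e , w≢z) with Fin.any? (λ y → (adj G x y Bool.≟ true) ×-dec (¬? (y Fin.≟ z) ×-dec ¬? (y Fin.≟ w)))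
      ...   | yes (y , e′ , y≢z , y≢w) = inj₁ (above (siblings (y≢w ∘ sym) down down′ (explore fuel down (deeper down)) (explore fuel down′ (deeper down′))))
        where
        down : Child w x
        down = other-child ch e w≢z
        down′ : Child y x
        down′ = other-child ch e′ y≢z
        deeper : ∀ {w} → Child w x → n ≤ fuel + dist (c zero) w
        deeper {w} down = subst (n ≤_) (trans (sym (+-suc fuel _)) (cong (fuel +_) (sym (lower down zero)))) le
        above : Hit w x ⊎ Hit y x → Hit x z
        above (inj₁ h) = hit-up down ch h
        above (inj₂ h) = hit-up down′ ch h
      ...   | no none = above (explore fuel down (subst (n ≤_) (trans (sym (+-suc fuel _)) (cong (fuel +_) (sym (lower down zero)))) le))
        where
        down : Child w x
        down = other-child ch e w≢z
        two : ∀ {y} → adj G x y ≡ true → y ∈ z ∷ w ∷ []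
        two {y} e′ with y Fin.≟ z | y Fin.≟ w
        ... | yes p | _     = here p
        ... | no _  | yes q = there (here q)
        ... | no p  | no q  = contradiction (y , e′ , p , q) none
        deg-x : deg G x ≡ 2
        deg-x = ≤-antisym (deg-≤ (z ∷ w ∷ []) two) (deg-≥ (((w≢z ∘ sym) ∷ []) ∷ [] ∷ []) λ { (here refl) → Child-adj ch ; (there (here refl)) → e })
        above : Hit w x ⊎ PureThread w x → Hit x z ⊎ PureThread x z
        above (inj₁ h)                = inj₁ (hit-up down ch h)
        above (inj₂ (us , chain , near)) = inj₂ (w ∷ us , more (Child-adj ch) deg-x (w≢z ∘ sym) chain ,
          λ { (here refl) → near-self ch ; (there y∈) → Near-trans down ch (near y∈) })

    -- Otherwise both subtrees would be threads at z avoiding S.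
    siblings-hit : ∀ {x y z} → x ≢ y → Child x z → Child y z → Hit x z ⊎ Hit y z
    siblings-hit {x} {y} x≢y p q = siblings x≢y p q (explore n p (m≤m+n n _)) (explore n q (m≤m+n n _))

    -- A branching vertex has two children: degree 3 less the parent, or degree 4 less the two cycle
    -- neighbours. `siblings-hit` then places a vertex of `S` below it.
    branchActive⇒Active : ∀ {i} → branchActive G C i ≡ true → Active i
    branchActive⇒Active {i} active with branchActive-elim active
    ... | x , p , b = found (branching-elim b)
      where
      below : ∀ {y w} → y ≢ w → Child y x → Child w x → Active i
      below ne chy chw with siblings-hit ne chy chw
      ... | inj₁ (s , s∈S , near) = s , s∈S , In-below chy p near
      ... | inj₂ (s , s∈S , near) = s , s∈S , In-below chw p near
      found : (¬ OnCycle x × 3 ≤ deg G x) ⊎ (OnCycle x × 4 ≤ deg G x) → Active i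
      found (inj₁ (off , d)) with parent off
      ... | z , up with new-neighbour (z ∷ []) (<-trans (n<1+n 1) d)
      ...   | y , ey , y∉ with new-neighbour (z ∷ y ∷ []) d
      ...     | w , ew , w∉ = below (λ y≡w → w∉ (there (here (sym y≡w))))
                (other-child up ey (λ y≡z → y∉ (here y≡z))) (other-child up ew (λ w≡z → w∉ (here w≡z)))
      found (inj₂ ((j , refl) , d)) with cycle-neighbours j
      ... | h , next-h , _ with new-neighbour (c (next j) ∷ c h ∷ []) (<-trans (n<1+n 2) d)
      ...   | y , ey , y∉ with new-neighbour (c (next j) ∷ c h ∷ y ∷ []) d
      ...     | w , ew , w∉ = below (λ y≡w → w∉ (there (there (here (sym y≡w)))))
                (down ey (λ eq → y∉ (here eq)) (λ eq → y∉ (there (here eq))))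
                (down ew (λ eq → w∉ (here eq)) (λ eq → w∉ (there (here eq))))
        where
        down : ∀ {y} → adj G (c j) y ≡ true → y ≢ c (next j) → y ≢ c h → Child y (c j)
        down e ne ne′ with edge-cases e
        ... | inj₁ b = cycle-child (j , refl) b
        ... | inj₂ (g , inj₁ (eq , eq′)) = contradiction (trans (sym eq′) (cong (λ i → c (next i)) (Cycle.inj C eq))) ne
        ... | inj₂ (g , inj₂ (eq , eq′)) =
          contradiction (trans (sym eq) (cong c (next-injective (trans (Cycle.inj C eq′) (sym next-h))))) ne′

    fork-resolved : ∀ {x y i} → In x i → In y i → dist (c i) x ≡ dist (c i) y → x ≢ y →
      ∃[ s ] (s Subset.∈ S × (2 + dist x s ≤ dist y s ⊎ 2 + dist y s ≤ dist x s))
    fork-resolved {x} {y} {i} p q eq x≢y = resolve (siblings-hit F.x′≢y′ F.childˣ F.childʸ)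
      where
      module F = Fork (fork {i = i} (dist (c i) y) p q eq refl x≢y)
      resolve : Hit F.x′ F.z ⊎ Hit F.y′ F.z → _
      resolve (inj₁ (s , s∈S , near)) = s , s∈S , inj₁ (fork-dist i F.x′≢y′ F.childˣ F.childʸ F.nearˣ F.nearʸ eq near)
      resolve (inj₂ (s , s∈S , near)) = s , s∈S , inj₂ (fork-dist i (F.x′≢y′ ∘ sym) F.childʸ F.childˣ F.nearʸ F.nearˣ (sym eq) near)

    -- f is the distance function of a vertex or edge in the tree at c i, at height h above c i.
    record Located (f : V → ℕ) (i : Fin K) (h : ℕ) : Set where
      field
        away : ∀ {s a} → In s a → i ≢ a → f s ≡ h + (cdist i a + dist (c a) s)
        within  : ∀ {s} → In s i → f s ≤ h + dist (c i) s
    open Located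

    Agree : (f g : V → ℕ) → Set
    Agree f g = ∀ {s} → s Subset.∈ S → f s ≡ g s

    vertex-located : ∀ {x i} → In x i → Located (dist x) i (dist (c i) x)
    vertex-located p .away q i≢a = dist-trees p q i≢a
    vertex-located {x} {i} p .within {s} q = dist-tree-≤ x s i

    -- Seen from outside the tree the upper end `z` is nearer, so the edge acts as a point at the
    -- height of `z`.
    edge-located : ∀ {x z i} → Child x z → In x i → Located (λ s → dist x s ⊓ dist z s) i (dist (c i) z)
    edge-located {x} {z} {i} ch p .away {s} {a} q i≢a = trans (m≥n⇒m⊓n≡n (≤-trans (n≤1+n _) (≤-reflexive (sym x≡)))) z≡
      where
      z≡ : dist z s ≡ dist (c i) z + (cdist i a + dist (c a) s)
      z≡ = dist-trees (In-up ch p) q i≢a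
      x≡ : dist x s ≡ suc (dist z s)
      x≡ = trans (dist-trees p q i≢a) (trans (cong (_+ (cdist i a + dist (c a) s)) (lower ch i)) (cong suc (sym z≡)))
    edge-located {x} {z} {i} ch p .within {s} q = ≤-trans (m⊓n≤n (dist x s) (dist z s)) (dist-tree-≤ z s i)

    cycle-edge : ∀ j {s a} → In s a → dist (c j) s ⊓ dist (c (next j)) s ≡ edist j a + dist (c a) s
    cycle-edge j {s} {a} p = trans (cong₂ _⊓_ (p j) (p (next j))) (sym (+-distribʳ-⊓ (dist (c a) s) (cdist j a) (cdist (next j) a)))

    cdist-pos : ∀ {i j} → i ≢ j → 0 < cdist i j
    cdist-pos i≢j = n≢0⇒n>0 λ eq → i≢j (Cycle.inj C (dist-zero eq))

    module _ (spread : Spread Active) where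

      open Spread spread

      -- `a` and `b` are the ends of a geodesic through the cycle edge at `j`; by the triangle
      -- inequality a route through `c i` is no shorter.
      detour : ∀ i j → ∃[ a ] ∃[ b ] (Active a × Active b × cdist j a + suc (cdist (next j) b) ≤ cdist i a + cdist i b)
      detour i j with cover j
      ... | a , b , Aa , Ab , le = a , b , Aa , Ab ,
        ≤-trans le (subst (λ d → cdist a b ≤ d + cdist i b) (dist-sym (c a) (c i)) (dist-triangle (c a) (c i) (c b)))

      active-elsewhere : ∀ i → ∃[ a ] (Active a × i ≢ a)
      active-elsewhere i with detour i i
      ... | a , b , Aa , Ab , le with i Fin.≟ a
      ...   | no i≢a = a , Aa , i≢a
      ...   | yes refl = b , Ab , λ { refl → n≮0 (≤-trans (m≤n+m _ _) (≤-trans le (≤-reflexive (cong₂ _+_ (dist-refl (c i)) (dist-refl (c i)))))) }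

      same-height : ∀ {f g i h h′} → Located f i h → Located g i h′ → Agree f g → h ≡ h′
      same-height {f} {g} {i} {h} {h′} F F′ agree with active-elsewhere i
      ... | a , (s , s∈S , q) , i≢a = +-cancelʳ-≡ (cdist i a + dist (c a) s) h h′
        (trans (sym (away F q i≢a)) (trans (agree s∈S) (away F′ q i≢a)))

      private
        -- The height of the sampled vertex cancels. The second outcome is a = i, where `within`
        -- bounds `f` only from above; a = j is impossible because h′ ≤ h.
        contrast : ∀ {f g i j h h′} → Located f i h → Located g j h′ → Agree f g → i ≢ j → h′ ≤ h → ∀ {a} → Active a →
          h + cdist i a ≡ h′ + cdist j a ⊎ (cdist i a ≡ 0 × h′ + cdist j a ≤ h × 0 < cdist j a)
        contrast {f} {g} {i} {j} {h} {h′} F F′ agree i≢j le {a} (s , s∈S , q) with i Fin.≟ a | j Fin.≟ a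
        ... | yes refl | yes refl = contradiction refl i≢j
        ... | yes refl | no j≢i = inj₂ (dist-refl (c i) ,
              lin 6 (λ h h′ d t f g → f :≤ h :+ t :⇒ f := g :⇒ g := h′ :+ (d :+ t) :⇒ ⊢ h′ :+ d :≤ h)
                h h′ (cdist j i) (dist (c i) s) (f s) (g s) (within F q) (agree s∈S) (away F′ q j≢i) , cdist-pos j≢i)
        ... | no i≢a | yes refl = ⊥-elim (lin 6 (λ h h′ d t f g → f := h :+ (d :+ t) :⇒ f := g :⇒ g :≤ h′ :+ t :⇒ h′ :≤ h :⇒ con 0 :< d :⇒ ⊢ :⊥)
                h h′ (cdist i j) (dist (c j) s) (f s) (g s) (away F q i≢a) (agree s∈S) (within F′ q) le (cdist-pos i≢a))
        ... | no i≢a | no j≢a = inj₁ (lin 7 (λ h h′ d e t f g → f := h :+ (d :+ t) :⇒ f := g :⇒ g := h′ :+ (e :+ t) :⇒ ⊢ h :+ d := h′ :+ e)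
                h h′ (cdist i a) (cdist j a) (dist (c a) s) (f s) (g s) (away F q i≢a) (agree s∈S) (away F′ q j≢a))

        ordered : ∀ {f g i j h h′} → Located f i h → Located g j h′ → Agree f g → i ≢ j → h′ ≤ h → ⊥
        ordered {i = i} {j} {h} {h′} F F′ agree i≢j le with m≤n⇒m<n∨m≡n le
        ... | inj₂ refl = i≢j (resolves λ Aa → same (contrast F F′ agree i≢j le Aa))
          where
          same : ∀ {d e} → h + d ≡ h + e ⊎ (d ≡ 0 × h + e ≤ h × 0 < e) → d ≡ e
          same {d} {e} (inj₁ eq)           = +-cancelˡ-≡ h d e eq
          same {d} {e} (inj₂ (_ , le , 0<)) = ⊥-elim (lin 2 (λ h e → h :+ e :≤ h :⇒ con 0 :< e :⇒ ⊢ :⊥) h e le 0<)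
        -- The root of the higher item would be strictly nearer than `c j` to all active points,
        -- although `c j` lies on a geodesic between two of them.
        ... | inj₁ lt with detour i j
        ...   | a , b , Aa , Ab , le′ = lin 5 (λ ia ib ja jb njb → ia :< ja :⇒ ib :< jb :⇒ jb :≤ con 1 :+ njb :⇒ ja :+ (con 1 :+ njb) :≤ ia :+ ib :⇒ ⊢ :⊥)
                (cdist i a) (cdist i b) (cdist j a) (cdist j b) (cdist (next j) b) (closer Aa) (closer Ab) (dist-adj (c b) (c-adj j)) le′
          where
          closer : ∀ {a} → Active a → cdist i a < cdist j a
          closer {a} Aa with contrast F F′ agree i≢j le Aa
          ... | inj₁ eq           = lin 4 (λ h h′ d e → h :+ d := h′ :+ e :⇒ h′ :< h :⇒ ⊢ d :< e) h h′ (cdist i a) (cdist j a) eq lt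
          ... | inj₂ (eq , _ , 0<) = subst (_< cdist j a) (sym eq) 0<

      same-tree : ∀ {f g i j h h′} → Located f i h → Located g j h′ → Agree f g → i ≡ j
      same-tree {i = i} {j} {h} {h′} F F′ agree = decidable-stable (i Fin.≟ j) λ i≢j → distinct i≢j (≤-total h′ h)
        where
        distinct : i ≢ j → h′ ≤ h ⊎ h ≤ h′ → ⊥
        distinct i≢j (inj₁ le) = ordered F F′ agree i≢j le
        distinct i≢j (inj₂ le) = ordered F′ F (λ s∈ → sym (agree s∈)) (i≢j ∘ sym) le

      -- Agreement would put `c i` no farther from each active point than the cycle edge is. The
      -- ends of a geodesic through that edge could then be joined through `c i`, saving the length
      -- of the edge.
      tree-vs-cycle : ∀ {f i h} j → Located f i h → ¬ Agree f (λ s → dist (c j) s ⊓ dist (c (next j)) s)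
      tree-vs-cycle {f} {i} {h} j F agree with detour i j
      ... | a , b , Aa , Ab , le = lin 6 (λ ia ib ja njb ea eb → ia :≤ ea :⇒ ib :≤ eb :⇒ ea :≤ ja :⇒ eb :≤ njb :⇒ ja :+ (con 1 :+ njb) :≤ ia :+ ib :⇒ ⊢ :⊥)
              (cdist i a) (cdist i b) (cdist j a) (cdist (next j) b) (edist j a) (edist j b) (below Aa) (below Ab)
              (m⊓n≤m (cdist j a) (cdist (next j) a)) (m⊓n≤n (cdist j b) (cdist (next j) b)) le
        where
        below : ∀ {a} → Active a → cdist i a ≤ edist j a
        below {a} (s , s∈S , q) with i Fin.≟ a
        ... | yes refl = subst (_≤ edist j i) (sym (dist-refl (c i))) z≤n
        ... | no i≢a   = lin 5 (λ h d e t f → f := h :+ (d :+ t) :⇒ f := e :+ t :⇒ ⊢ d :≤ e)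
              h (cdist i a) (edist j a) (dist (c a) s) (f s) (away F q i≢a) (trans (agree s∈S) (cycle-edge j q))

      private
        witness : ∀ (f g : V → ℕ) → ¬ Agree f g → ∃[ s ] (s Subset.∈ S × f s ≢ g s)
        witness f g ¬agree with Fin.any? (λ s → (s ∈ˢ? S) ×-dec ¬? (f s ≟ g s))
        ... | yes found = found
        ... | no none   = contradiction (λ {s} s∈S → decidable-stable (f s ≟ g s) λ ne → none (s , s∈S , ne)) ¬agree

      -- Agreement on `S` forces first the same tree and then the same height, where a fork
      -- contradicts it.
      Spread⇒Resolves : Resolves S
      Spread⇒Resolves u v u≢v = witness (dist u) (dist v) disagree
        where
        gap : ∀ {a b} → a ≡ b → ¬ (2 + a ≤ b)
        gap {a} refl le = 1+n≰n (≤-trans (n≤1+n (suc a)) le)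
        disagree : ¬ Agree (dist u) (dist v)
        disagree agree = split (fork-resolved p q (same-height (vertex-located p) (vertex-located q) agree) u≢v)
          where
          i = proj₁ (root u)
          p = proj₂ (root u)
          q : In v i
          q = subst (In v) (sym (same-tree (vertex-located p) (vertex-located (proj₂ (root v))) agree)) (proj₂ (root v))
          split : ∃[ s ] (s Subset.∈ S × (2 + dist u s ≤ dist v s ⊎ 2 + dist v s ≤ dist u s)) → ⊥
          split (s , s∈S , inj₁ le) = gap (agree s∈S) le
          split (s , s∈S , inj₂ le) = gap (sym (agree s∈S)) le

      EdgeKind : V → V → Set
      EdgeKind u v = (∃[ j ] SameEdge G u v (c j) (c (next j))) ⊎ (∃[ x ] ∃[ z ] (Child x z × SameEdge G u v x z))

      edge-kind : ∀ {u v} → adj G u v ≡ true → EdgeKind u v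
      edge-kind e with edge-cases e
      ... | inj₂ (j , inj₁ (p , q)) = inj₁ (j , inj₁ (sym p , sym q))
      ... | inj₂ (j , inj₂ (p , q)) = inj₁ (j , inj₂ (sym q , sym p))
      ... | inj₁ b with bridge-Child b
      ...   | inj₁ ch = inj₂ (_ , _ , ch , inj₁ (refl , refl))
      ...   | inj₂ ch = inj₂ (_ , _ , ch , inj₂ (refl , refl))

      private
        sameEdge-dist : ∀ {u v x z} → SameEdge G u v x z → ∀ s → dist u s ⊓ dist v s ≡ dist x s ⊓ dist z s
        sameEdge-dist (inj₁ (refl , refl)) s = refl
        sameEdge-dist {u} {v} (inj₂ (refl , refl)) s = ⊓-comm (dist u s) (dist v s)

        sameEdge-trans : ∀ {u v u′ v′ x z} → SameEdge G u v x z → SameEdge G u′ v′ x z → SameEdge G u v u′ v′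
        sameEdge-trans (inj₁ (refl , refl)) (inj₁ (refl , refl)) = inj₁ (refl , refl)
        sameEdge-trans (inj₁ (refl , refl)) (inj₂ (refl , refl)) = inj₂ (refl , refl)
        sameEdge-trans (inj₂ (refl , refl)) (inj₁ (refl , refl)) = inj₂ (refl , refl)
        sameEdge-trans (inj₂ (refl , refl)) (inj₂ (refl , refl)) = inj₁ (refl , refl)

        -- Distinct lower ends of equal height differ by at least two in distance from some vertex
        -- of `S`, and the minimum with the upper end lowers a distance by at most one.
        tree-edges : ∀ {x z x′ z′} → Child x z → Child x′ z′ → Agree (λ s → dist x s ⊓ dist z s) (λ s → dist x′ s ⊓ dist z′ s) → x ≡ x′
        tree-edges {x} {z} {x′} {z′} ch ch′ agree with root x | root x′
        ... | i , p | j , q with same-tree (edge-located ch p) (edge-located ch′ q) agree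
        ...   | refl = decidable-stable (x Fin.≟ x′) λ x≢x′ → absurd (fork-resolved p q heights x≢x′)
          where
          heights : dist (c i) x ≡ dist (c i) x′
          heights = trans (lower ch i) (trans (cong suc (same-height (edge-located ch p) (edge-located ch′ q) agree)) (sym (lower ch′ i)))
          close : ∀ {x z x′ z′} s → Child x′ z′ → dist x s ⊓ dist z s ≡ dist x′ s ⊓ dist z′ s → 2 + dist x s ≤ dist x′ s → ⊥
          close {x} {z} {x′} {z′} s ch′ eq le = lin 4 (λ a b d e → con 2 :+ a :≤ b :⇒ b :≤ con 1 :+ d :⇒ e :≤ a :⇒ d :≤ e :⇒ ⊢ :⊥)
            (dist x s) (dist x′ s) (dist z′ s) (dist x s ⊓ dist z s) le z-near (m⊓n≤m (dist x s) (dist z s))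
            (≤-reflexive (trans (sym (m≥n⇒m⊓n≡n z≤x)) (sym eq)))
            where
            z-near : dist x′ s ≤ suc (dist z′ s)
            z-near = dist-adj s (Child-adj ch′)
            z≤x : dist z′ s ≤ dist x′ s
            z≤x = ≮⇒≥ λ x<z → lin 5 (λ a b d e m → m := b :⇒ m := e :⇒ e :≤ a :⇒ con 2 :+ a :≤ b :⇒ ⊢ :⊥)
              (dist x s) (dist x′ s) (dist z′ s) (dist x s ⊓ dist z s) (dist x′ s ⊓ dist z′ s)
              (m≤n⇒m⊓n≡m (<⇒≤ x<z)) (sym eq) (m⊓n≤m (dist x s) (dist z s)) le
          absurd : ∃[ s ] (s Subset.∈ S × (2 + dist x s ≤ dist x′ s ⊎ 2 + dist x′ s ≤ dist x s)) → ⊥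
          absurd (s , s∈S , inj₁ le) = close s ch′ (agree s∈S) le
          absurd (s , s∈S , inj₂ le) = close s ch (sym (agree s∈S)) le

      Spread⇒ResolvesEdges : ResolvesEdges S
      Spread⇒ResolvesEdges u v u′ v′ e e′ ne = witness (λ s → dist u s ⊓ dist v s) (λ s → dist u′ s ⊓ dist v′ s)
          λ agree → disagree agree (edge-kind e) (edge-kind e′)
        where
        transport : ∀ {x z x′ z′} → SameEdge G u v x z → SameEdge G u′ v′ x′ z′ →
          Agree (λ s → dist u s ⊓ dist v s) (λ s → dist u′ s ⊓ dist v′ s) → Agree (λ s → dist x s ⊓ dist z s) (λ s → dist x′ s ⊓ dist z′ s)
        transport p q agree {s} s∈S = trans (sym (sameEdge-dist p s)) (trans (agree s∈S) (sameEdge-dist q s))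
        disagree : Agree (λ s → dist u s ⊓ dist v s) (λ s → dist u′ s ⊓ dist v′ s) → EdgeKind u v → EdgeKind u′ v′ → ⊥
        disagree agree (inj₁ (j , p)) (inj₁ (j′ , q)) = ne (sameEdge-trans p (subst (λ h → SameEdge G u′ v′ (c h) (c (next h))) (sym j≡j′) q))
          where
          same-edist : ∀ {a} → Active a → edist j a ≡ edist j′ a
          same-edist {a} (s , s∈S , r) = +-cancelʳ-≡ (dist (c a) s) (edist j a) (edist j′ a)
            (trans (sym (cycle-edge j r)) (trans (transport p q agree s∈S) (cycle-edge j′ r)))
          j≡j′ : j ≡ j′
          j≡j′ = resolves-edges same-edist
        disagree agree (inj₂ (x , z , ch , p)) (inj₁ (j , q)) =
          tree-vs-cycle j (edge-located ch (proj₂ (root x))) (transport p q agree)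
        disagree agree (inj₁ (j , p)) (inj₂ (x , z , ch , q)) =
          tree-vs-cycle j (edge-located ch (proj₂ (root x))) (λ s∈S → sym (transport p q agree s∈S))
        disagree agree (inj₂ (x , z , ch , p)) (inj₂ (x′ , z′ , ch′ , q)) with tree-edges ch ch′ (transport p q agree)
        ... | refl = ne (sameEdge-trans p (subst (SameEdge G u′ v′ x) (parent-unique ch′ ch) q))

length-concatMap-≤ : ∀ {A B : Set} (f : A → List B) (g : A → ℕ) → (∀ x → length (f x) ≤ g x) →
                     ∀ xs → length (concatMap f xs) ≤ sum (map g xs)
length-concatMap-≤ f g le []       = z≤n
length-concatMap-≤ f g le (x ∷ xs) =
  subst (_≤ g x + sum (map g xs)) (sym (length-++ (f x))) (+-mono-≤ (le x) (length-concatMap-≤ f g le xs))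

-- The resolving set and the two possible values

module Construction {n : ℕ} (G : Graph n) (conn : Connected G) (C : Cycle G) (uniq : OnlyCycle G C) where

  open Structure G conn C uniq
  open CycleMetric G conn C uniq
  open Threads G conn C uniq
  open LowerBound G conn C uniq
  open UpperBound G conn C uniq

  heads : List (List V) → List V
  heads = concatMap (take 1)

  -- The head alone suffices for a thread to be met; the first listed thread at `v` is the one left
  -- out.
  spareHeads : V → List V
  spareHeads v = heads (drop 1 (threadsAt v))

  base-set : List V
  base-set = concatMap spareHeads (allFin n)

  length-base-set : length base-set ≤ LG G
  length-base-set = length-concatMap-≤ spareHeads (λ v → excess (ℓ G v)) bounded (allFin n)
    where
    length-heads : ∀ ls → length (heads ls) ≤ length ls
    length-heads []             = z≤n
    length-heads ([] ∷ ls)      = m≤n⇒m≤1+n (length-heads ls)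
    length-heads ((_ ∷ _) ∷ ls) = s≤s (length-heads ls)
    bounded : ∀ v → length (spareHeads v) ≤ excess (ℓ G v)
    bounded v = ≤-trans (length-heads (drop 1 (threadsAt v))) (≤-reflexive
      (trans (length-drop 1 (threadsAt v)) (trans (cong (_∸ 1) (length-threadsAt v)) (sym (excess≡pred (ℓ G v))))))

  base-set-BranchResolving : ∀ {S} → (∀ {x} → x ∈ base-set → x Subset.∈ S) → BranchResolving S
  base-set-BranchResolving {S} sub {v} {l} {l′} t t′ l≢l′ = choose (threadsAt v) refl (threadsAt-complete t) (threadsAt-complete t′)
    where
    hit : ∀ {k l ls} → threadsAt v ≡ k ∷ ls → Thread v l → l ∈ ls → ∃[ s ] (s Subset.∈ S × s ∈ l)
    hit {l = u ∷ us} eq t l∈ = u , sub (∈-concatMap⁺ spareHeads (lose (∈-allFin v)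
      (subst (λ ks → u ∈ heads (drop 1 ks)) (sym eq) (∈-concatMap⁺ (take 1) (lose l∈ (here refl)))))) , here refl
    choose : ∀ ls → threadsAt v ≡ ls → l ∈ ls → l′ ∈ ls → ∃[ s ] (s Subset.∈ S × (s ∈ l ⊎ s ∈ l′))
    choose (k ∷ ls) eq (here refl) (here refl) = contradiction refl l≢l′
    choose (k ∷ ls) eq (there l∈)  _           = let s , s∈S , s∈l = hit eq t l∈ in s , s∈S , inj₁ s∈l
    choose (k ∷ ls) eq (here refl) (there l′∈) = let s , s∈S , s∈l′ = hit eq t′ l′∈ in s , s∈S , inj₂ s∈l′

  -- Two distinct roots to be occupied. A branch-active one needs no vertex of its own, and each one
  -- lacking is paid for by a cycle vertex, which explains `size`.
  record Anchors : Set where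
    field
      α β      : Fin K
      α≢β      : α ≢ β
      extra    : List V
      size     : length extra ≡ 2 ∸ bG G C
      anchorα  : branchActive G C α ≡ true ⊎ c α ∈ extra
      anchorβ  : branchActive G C β ≡ true ⊎ c β ∈ extra

  anchors : Anchors
  anchors = pick (bG G C) refl
    where
    i≢next : ∀ i → i ≢ next i
    i≢next i eq = adj-≢ (c-adj i) (cong c eq)
    pick : ∀ b → bG G C ≡ b → Anchors
    pick zero eq = record { α≢β = i≢next zero ; extra = c zero ∷ c (next zero) ∷ [] ; size = cong (2 ∸_) (sym eq)
      ; anchorα = inj₂ (here refl) ; anchorβ = inj₂ (there (here refl)) }
    pick (suc zero) eq with countB-fresh (branchActive G C) [] (subst (0 <_) (sym eq) z<s)
    ... | i , active , _ = record { α≢β = i≢next i ; extra = c (next i) ∷ [] ; size = cong (2 ∸_) (sym eq)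
      ; anchorα = inj₁ active ; anchorβ = inj₂ (here refl) }
    pick (suc (suc b)) eq with countB-fresh (branchActive G C) [] (subst (0 <_) (sym eq) z<s)
    ... | i , active , _ with countB-fresh (branchActive G C) (i ∷ []) (subst (1 <_) (sym eq) (s≤s z<s))
    ...   | j , active′ , j∉ = record { α≢β = λ i≡j → j∉ (here (sym i≡j)) ; extra = [] ; size = sym (trans (cong (2 ∸_) eq) (0∸n≡0 b))
      ; anchorα = inj₁ active ; anchorβ = inj₁ active′ }

  -- The `suc` pays for `c γ`; repetitions in the list can only make the set smaller.
  upper-bound : ∃[ S ] (Resolves S × ResolvesEdges S × ∣ S ∣ ≤ suc (LG G + (2 ∸ bG G C)))
  upper-bound = S , Spread⇒Resolves S br spread , Spread⇒ResolvesEdges S br spread , size-S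
    where
    open Anchors anchors
    third = third-point α≢β
    γ = proj₁ third
    chosen-list : List V
    chosen-list = c γ ∷ extra ++ base-set
    S : Subset n
    S = fromList chosen-list
    br : BranchResolving S
    br = base-set-BranchResolving (λ x∈ → ∈-fromList {xs = chosen-list} (there (∈-++⁺ʳ extra x∈)))
    active : ∀ {i} → branchActive G C i ≡ true ⊎ c i ∈ extra → Active S br i
    active     (inj₁ a)  = branchActive⇒Active S br a
    active {i} (inj₂ i∈) = c i , ∈-fromList {xs = chosen-list} (there (∈-++⁺ˡ i∈)) , In-c i
    spread : Spread (Active S br)
    spread = proj₂ third {Active S br} (active anchorα) (active anchorβ) (c γ , ∈-fromList {xs = chosen-list} (here refl) , In-c γ)
    size-S : ∣ S ∣ ≤ suc (LG G + (2 ∸ bG G C))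
    size-S = begin
      ∣ S ∣                                      ≤⟨ ∣fromList∣-≤ chosen-list ⟩
      suc (length (extra ++ base-set))           ≡⟨ cong suc (length-++ extra) ⟩
      suc (length extra + length base-set)       ≤⟨ s≤s (+-mono-≤ (≤-reflexive size) length-base-set) ⟩
      suc (2 ∸ bG G C + LG G)                    ≡⟨ cong suc (+-comm (2 ∸ bG G C) (LG G)) ⟩
      suc (LG G + (2 ∸ bG G C))                  ∎
      where open ≤-Reasoning

  Resolving⇔ : ∀ {S} → (Resolving G S → Resolves S) × (Resolves S → Resolving G S)
  Resolving⇔ = (λ r u v u≢v → let s , s∈S , a , b , p , q , a≢b = r u v u≢v in
                  s , s∈S , λ eq → a≢b (trans (IsDist⇒≡ p) (trans eq (sym (IsDist⇒≡ q))))) ,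
               (λ r u v u≢v → let s , s∈S , ne = r u v u≢v in s , s∈S , _ , _ , dist-isDist u s , dist-isDist v s , ne)

  EdgeResolving⇔ : ∀ {S} → (EdgeResolving G S → ResolvesEdges S) × (ResolvesEdges S → EdgeResolving G S)
  EdgeResolving⇔ = (λ r u v u′ v′ e e′ ne → let s , s∈S , a , b , p , q , a≢b = r u v u′ v′ e e′ ne in
                      s , s∈S , λ eq → a≢b (trans (edge≡ p) (trans eq (sym (edge≡ q))))) ,
                   (λ r u v u′ v′ e e′ ne → let s , s∈S , d≢ = r u v u′ v′ e e′ ne in s , s∈S , _ , _ , isEdgeDist u v s , isEdgeDist u′ v′ s , d≢)
    where
    edge≡ : ∀ {u v s k} → IsEdgeDist G u v s k → k ≡ dist u s ⊓ dist v s
    edge≡ (a , b , p , q , eq) = trans eq (cong₂ _⊓_ (IsDist⇒≡ p) (IsDist⇒≡ q))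
    isEdgeDist : ∀ u v s → IsEdgeDist G u v s (dist u s ⊓ dist v s)
    isEdgeDist u v s = _ , _ , dist-isDist u s , dist-isDist v s , refl

  Resolves? : ∀ S → Dec (Resolves S)
  Resolves? S = Fin.all? λ u → Fin.all? λ v → ¬? (u Fin.≟ v) →-dec Fin.any? λ s → (s ∈ˢ? S) ×-dec ¬? (dist u s ≟ dist v s)

  ResolvesEdges? : ∀ S → Dec (ResolvesEdges S)
  ResolvesEdges? S = Fin.all? λ u → Fin.all? λ v → Fin.all? λ u′ → Fin.all? λ v′ →
    (adj G u v Bool.≟ true) →-dec ((adj G u′ v′ Bool.≟ true) →-dec (¬? (sameEdge? u v u′ v′) →-dec
      Fin.any? λ s → (s ∈ˢ? S) ×-dec ¬? (dist u s ⊓ dist v s ≟ dist u′ s ⊓ dist v′ s)))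
    where
    sameEdge? : ∀ u v u′ v′ → Dec (SameEdge G u v u′ v′)
    sameEdge? u v u′ v′ = ((u Fin.≟ u′) ×-dec (v Fin.≟ v′)) ⊎-dec ((u Fin.≟ v′) ×-dec (v Fin.≟ u′))

-- Finite search decides between the two values: either a set of size exactly `L` works, or the
-- lower bound rises to `suc L`, which the given set attains. `R` is the decidable form of the
-- defining property `P`.
minimum-size : ∀ {n} {R P : Subset n → Set} → (∀ {S} → (P S → R S) × (R S → P S)) → (∀ S → Dec (R S)) →
  ∀ L → (∀ S → R S → L ≤ ∣ S ∣) → ∃[ S ] (R S × ∣ S ∣ ≤ suc L) →
  ∃[ k ] (((∃[ S ] (P S × ∣ S ∣ ≡ k)) × (∀ S → P S → k ≤ ∣ S ∣)) × (k ≡ L ⊎ k ≡ suc L))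
minimum-size {R = R} equiv R? L lower (S , r , S≤) with anySubset? (λ S → R? S ×-dec (∣ S ∣ ≟ L))
... | yes (S′ , r′ , eq) = L , ((S′ , proj₂ equiv r′ , eq) , λ T p → lower T (proj₁ equiv p)) , inj₁ refl
... | no none = suc L , ((S , proj₂ equiv r , ≤-antisym S≤ (above S r)) , λ T p → above T (proj₁ equiv p)) , inj₂ refl
  where
  above : ∀ T → R T → suc L ≤ ∣ T ∣
  above T r = ≤∧≢⇒< (lower T r) λ eq → none (T , r , sym eq)

theorem7 : ∀ {n : ℕ} (G : Graph n) → Connected G → (C : Cycle G) →
    (∀ (C' : Cycle G) → SameCycle G C C') →
    (∃[ k ] (IsDim G k × (k ≡ LG G + (2 ∸ bG G C) ⊎ k ≡ suc (LG G + (2 ∸ bG G C)))))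
    × (∃[ k ] (IsEdgeDim G k × (k ≡ LG G + (2 ∸ bG G C) ⊎ k ≡ suc (LG G + (2 ∸ bG G C)))))
theorem7 G conn C same =
  minimum-size Resolving⇔ Resolves? (LG G + (2 ∸ bG G C))
    (λ S r → lower-bound S (Resolves⇒BranchResolving r) (Resolves⇒Biactive r)) (S , r , size) ,
  minimum-size EdgeResolving⇔ ResolvesEdges? (LG G + (2 ∸ bG G C))
    (λ S r → lower-bound S (ResolvesEdges⇒BranchResolving r) (ResolvesEdges⇒Biactive r)) (S , rᵉ , size)
  where
  open LowerBound G conn C (only same)
  open Construction G conn C (only same)
  S    = proj₁ upper-bound
  r    = proj₁ (proj₂ upper-bound)
  rᵉ   = proj₁ (proj₂ (proj₂ upper-bound))
  size = proj₂ (proj₂ (proj₂ upper-bound))
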